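{- Let $d\ge 2$ be an integer and let $p\in(0,1)$ be constant. Starting from the unit mass $\delta_\rho$ at the root $\rho$ of the $d$-ary tree $\mathbb{T}_d$, the minimum number of toppling moves needed to transport mass $p$ to distance at least $n$ from the root satisfies $$N_p(\mathbb{T}_d,B_n,\delta_\rho)=\Theta(d^n),$$ i.e. there exist constants $0<c\le C<\infty$ and $n_0$, depending only on $d$ and $p$, such that $c\,d^n\le N_p(\mathbb{T}_d,B_n,\delta_\rho)\le C\,d^n$ for all integers $n\ge n_0$.
   Context: The $d$-ary tree $\mathbb{T}_d$ is the infinite rooted tree in which every vertex has exactly $d$ children (so the root $\rho$ has degree $d$ and all other vertices have degree $d+1$). Toppling: let $G=(V,E)$ be a connected, locally finite graph, and write $y\sim v$ when $y,v$ are adjacent and $\mathcal{N}_v=\{y:y\sim v\}$. A mass distribution is a function $\mu:V\to[0,\infty)$. For a vertex $v$ with $\mu(v)>0$ and $0<m\le\mu(v)$, the toppling move $T_v^m$ topples mass $m$ at $v$ equally to its neighbours: $T_v^m\mu=\mu-m\delta_v+\frac{m}{|\mathcal{N}_v|}\sum_{y\sim v}\delta_y$. For $A\subset V$, $p>0$ and an initial mass distribution $\mu_0$, $N_p(G,A,\mu_0)$ is the minimum number of successive toppling moves needed to obtain from $\mu_0$ a mass distribution $\mu$ with $\sum_{v\notin A}\mu(v)\ge p$ (and $\infty$ if this is impossible). $B_n=\{u\in V: d_G(u,\rho)<n\}$ is the open ball of radius $n$ around $\rho$ in the graph distance $d_G$. -}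

module Defs where

open import Level using (0ℓ)
open import Axiom.ExcludedMiddle using (ExcludedMiddle)
open import Data.Fin.Base using (Fin)
import Data.Fin.Properties as Fin
open import Data.Integer.Base using (+_)
open import Data.List.Base using (List; []; _∷_; _++_; map; foldr; length; allFin)
open import Data.List.Membership.Propositional using (_∈_)
open import Data.List.Membership.Propositional.Properties
  using (∈-map⁺; ∈-map⁻; ∈-++⁺ˡ; ∈-++⁺ʳ; ∈-++⁻; ∈-allFin)
open import Data.List.Properties using (≡-dec; ∷-injectiveˡ)
open import Data.List.Relation.Unary.All using (All)
open import Data.List.Relation.Unary.Any using (here; there)
open import Data.List.Relation.Unary.AllPairs using ([]; _∷_)
import Data.List.Relation.Unary.All as All
open import Data.List.Relation.Unary.Unique.Propositional using (Unique)
import Data.List.Relation.Unary.Unique.Propositional.Properties as Unique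
import Data.Maybe.Base as Maybe
open import Data.Nat.Base as ℕ using (ℕ; zero; suc; _⊔_)
import Data.Nat.Properties as ℕ
open import Data.Nat.Induction using (<-rec)
open import Data.Product.Base using (∃; ∃-syntax; _×_; _,_; proj₁; proj₂)
open import Data.Rational.Base as ℚ using (ℚ; 0ℚ; 1ℚ; ½)
import Data.Rational.Properties as ℚ
import Data.Rational.Solver as ℚ
open import Data.Sum.Base using (_⊎_; inj₁; inj₂; swap)
open import Function.Bundles using (_⇔_; mk⇔)
open import Relation.Binary.Definitions using (DecidableEquality)
open import Relation.Binary.PropositionalEquality
  using (_≡_; refl; sym; trans; cong; subst)
open import Relation.Nullary.Construct.Add.Supremum using (_⁺; ⊤⁺; [_])
import Relation.Binary.Construct.Add.Supremum.NonStrict as NonStrict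
import Relation.Binary.Construct.Add.Supremum.Strict as Strict
open import Relation.Nullary using (¬_; yes; no)
open import Relation.Unary using (Pred)

-- Real numbers: Cauchy sequences of rationals, with pointwise operations.
-- Everything below uses reals only through _≤ᴿ_ and _<ᴿ_, which do
-- not distinguish equivalent sequences, so no quotient is needed.

IsCauchy : (ℕ → ℚ) → Set
IsCauchy x = ∀ ε → 0ℚ ℚ.< ε →
  ∃[ N ] ∀ m n → N ℕ.≤ m → N ℕ.≤ n → ℚ.∣ x m ℚ.- x n ∣ ℚ.≤ ε

record ℝ : Set where
  field
    seq    : ℕ → ℚ
    cauchy : IsCauchy seq

open ℝ public

infix 4 _≤ᴿ_ _<ᴿ_

_≤ᴿ_ : ℝ → ℝ → Set
x ≤ᴿ y = ∀ ε → 0ℚ ℚ.< ε → ∃[ N ] ∀ n → N ℕ.≤ n → seq x n ℚ.≤ seq y n ℚ.+ ε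

_<ᴿ_ : ℝ → ℝ → Set
x <ᴿ y = ∃[ ε ] 0ℚ ℚ.< ε × ∃[ N ] ∀ n → N ℕ.≤ n → seq x n ℚ.+ ε ℚ.≤ seq y n

private
  open ℚ.+-*-Solver

  halves : ∀ ε → ½ ℚ.* ε ℚ.+ ½ ℚ.* ε ≡ ε
  halves ε = trans (sym (ℚ.*-distribʳ-+ ε ½ ½)) (ℚ.*-identityˡ ε)

  half-pos : ∀ {ε} → 0ℚ ℚ.< ε → 0ℚ ℚ.< ½ ℚ.* ε
  half-pos {ε} 0<ε = subst (ℚ._< ½ ℚ.* ε) (ℚ.*-zeroʳ ½) (ℚ.*-monoʳ-<-pos ½ 0<ε)

  shrink : ∀ q ε → 0ℚ ℚ.< ε → ∃[ η ] 0ℚ ℚ.< η × ℚ.∣ q ∣ ℚ.* η ℚ.≤ ε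
  shrink q ε 0<ε = η , 0<η , bound
    where
    r = ℚ.∣ q ∣ ℚ.+ 1ℚ
    instance
      nn : ℚ.NonNegative ℚ.∣ q ∣
      nn = ℚ.∣-∣-nonNeg q
      r>0 : ℚ.Positive r
      r>0 = ℚ.nonNeg+pos⇒pos ℚ.∣ q ∣ 1ℚ
      r≢0 : ℚ.NonZero r
      r≢0 = ℚ.pos⇒nonZero r
      1/r>0 : ℚ.Positive (ℚ.1/ r)
      1/r>0 = ℚ.1/pos⇒pos r
      ε>0 : ℚ.Positive ε
      ε>0 = ℚ.positive 0<ε
    η = ℚ.1/ r ℚ.* ε
    instance
      η>0 : ℚ.Positive η
      η>0 = ℚ.pos*pos⇒pos (ℚ.1/ r) ε
      η≥0 : ℚ.NonNegative η
      η≥0 = ℚ.pos⇒nonNeg η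
    0<η : 0ℚ ℚ.< η
    0<η = ℚ.positive⁻¹ η
    ∣q∣≤r : ℚ.∣ q ∣ ℚ.≤ r
    ∣q∣≤r = subst (ℚ._≤ r) (ℚ.+-identityʳ ℚ.∣ q ∣)
      (ℚ.+-monoʳ-≤ ℚ.∣ q ∣ {0ℚ} {1ℚ} (ℚ.nonNegative⁻¹ 1ℚ))
    open ℚ.≤-Reasoning
    bound : ℚ.∣ q ∣ ℚ.* η ℚ.≤ ε
    bound = begin
      ℚ.∣ q ∣ ℚ.* η              ≤⟨ ℚ.*-monoʳ-≤-nonNeg η ∣q∣≤r ⟩
      r ℚ.* η                    ≡⟨ ℚ.*-assoc r (ℚ.1/ r) ε ⟨
      (r ℚ.* ℚ.1/ r) ℚ.* ε       ≡⟨ cong (ℚ._* ε) (ℚ.*-inverseʳ r) ⟩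
      1ℚ ℚ.* ε                   ≡⟨ ℚ.*-identityˡ ε ⟩
      ε                          ∎

fromℚ : ℚ → ℝ
fromℚ q = record
  { seq    = λ _ → q
  ; cauchy = λ ε 0<ε → 0 , λ _ _ _ _ →
      subst (ℚ._≤ ε) (sym (cong ℚ.∣_∣ (ℚ.+-inverseʳ q))) (ℚ.<⇒≤ 0<ε)
  }

fromℕ : ℕ → ℚ
fromℕ k = + k ℚ./ 1

0ᴿ 1ᴿ : ℝ
0ᴿ = fromℚ 0ℚ
1ᴿ = fromℚ 1ℚ

infixl 6 _+ᴿ_ _-ᴿ_
infixl 7 _·_

_+ᴿ_ : ℝ → ℝ → ℝ
x +ᴿ y = record
  { seq    = λ n → seq x n ℚ.+ seq y n
  ; cauchy = λ ε 0<ε →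
      let M , xM = cauchy x (½ ℚ.* ε) (half-pos 0<ε)
          N , yN = cauchy y (½ ℚ.* ε) (half-pos 0<ε)
      in M ⊔ N , λ m n h k →
        bound ε m n (xM m n (ℕ.m⊔n≤o⇒m≤o M N h) (ℕ.m⊔n≤o⇒m≤o M N k))
                    (yN m n (ℕ.m⊔n≤o⇒n≤o M N h) (ℕ.m⊔n≤o⇒n≤o M N k))
  }
  where
  open ℚ.≤-Reasoning
  bound : ∀ ε m n →
    ℚ.∣ seq x m ℚ.- seq x n ∣ ℚ.≤ ½ ℚ.* ε →
    ℚ.∣ seq y m ℚ.- seq y n ∣ ℚ.≤ ½ ℚ.* ε →
    ℚ.∣ (seq x m ℚ.+ seq y m) ℚ.- (seq x n ℚ.+ seq y n) ∣ ℚ.≤ ε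
  bound ε m n p q = begin
    ℚ.∣ (a ℚ.+ b) ℚ.- (c ℚ.+ e) ∣
      ≡⟨ cong ℚ.∣_∣ (solve 4 (λ a b c e → (a :+ b) :- (c :+ e) := (a :- c) :+ (b :- e))
                       refl a b c e) ⟩
    ℚ.∣ (a ℚ.- c) ℚ.+ (b ℚ.- e) ∣            ≤⟨ ℚ.∣p+q∣≤∣p∣+∣q∣ (a ℚ.- c) (b ℚ.- e) ⟩
    ℚ.∣ a ℚ.- c ∣ ℚ.+ ℚ.∣ b ℚ.- e ∣          ≤⟨ ℚ.+-mono-≤ p q ⟩
    ½ ℚ.* ε ℚ.+ ½ ℚ.* ε                      ≡⟨ halves ε ⟩
    ε                                        ∎
    where a = seq x m
          b = seq y m
          c = seq x n
          e = seq y n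

_·_ : ℚ → ℝ → ℝ
q · x = record
  { seq    = λ n → q ℚ.* seq x n
  ; cauchy = λ ε 0<ε →
      let η , 0<η , qη≤ε = shrink q ε 0<ε
          N , xN = cauchy x η 0<η
      in N , λ m n h k → bound ε η qη≤ε m n (xN m n h k)
  }
  where
  open ℚ.≤-Reasoning
  bound : ∀ ε η → ℚ.∣ q ∣ ℚ.* η ℚ.≤ ε → ∀ m n →
    ℚ.∣ seq x m ℚ.- seq x n ∣ ℚ.≤ η →
    ℚ.∣ q ℚ.* seq x m ℚ.- q ℚ.* seq x n ∣ ℚ.≤ ε
  bound ε η qη≤ε m n p = begin
    ℚ.∣ q ℚ.* a ℚ.- q ℚ.* b ∣
      ≡⟨ cong ℚ.∣_∣ (solve 3 (λ q a b → q :* a :- q :* b := q :* (a :- b)) refl q a b) ⟩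
    ℚ.∣ q ℚ.* (a ℚ.- b) ∣        ≡⟨ ℚ.∣p*q∣≡∣p∣*∣q∣ q (a ℚ.- b) ⟩
    ℚ.∣ q ∣ ℚ.* ℚ.∣ a ℚ.- b ∣    ≤⟨ ℚ.*-monoˡ-≤-nonNeg ℚ.∣ q ∣ {{ℚ.∣-∣-nonNeg q}} p ⟩
    ℚ.∣ q ∣ ℚ.* η                ≤⟨ qη≤ε ⟩
    ε                            ∎
    where a = seq x m
          b = seq x n

_-ᴿ_ : ℝ → ℝ → ℝ
x -ᴿ y = x +ᴿ (ℚ.- 1ℚ) · y

sumᴿ : List ℝ → ℝ
sumᴿ = foldr _+ᴿ_ 0ᴿ

sumℚ : List ℚ → ℚ
sumℚ = foldr ℚ._+_ 0ℚ

private
  fromℚ-nonneg : ∀ {q} → 0ℚ ℚ.≤ q → 0ᴿ ≤ᴿ fromℚ q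
  fromℚ-nonneg {q} 0≤q ε 0<ε = 0 , λ _ _ → ℚ.+-mono-≤ 0≤q (ℚ.<⇒≤ 0<ε)

  <⇒0≤ : ∀ {x} → 0ᴿ <ᴿ x → 0ᴿ ≤ᴿ x
  <⇒0≤ {x} (η , 0<η , N , h) ε 0<ε = N , λ n k →
    ℚ.≤-trans (ℚ.<⇒≤ (subst (0ℚ ℚ.<_) (sym (ℚ.+-identityˡ η)) 0<η))
      (ℚ.≤-trans (h n k)
        (subst (ℚ._≤ seq x n ℚ.+ ε) (ℚ.+-identityʳ (seq x n))
          (ℚ.+-monoʳ-≤ (seq x n) (ℚ.<⇒≤ 0<ε))))

  +-nonneg : ∀ {x y} → 0ᴿ ≤ᴿ x → 0ᴿ ≤ᴿ y → 0ᴿ ≤ᴿ x +ᴿ y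
  +-nonneg {x} {y} p q ε 0<ε =
    let M , pM = p (½ ℚ.* ε) (half-pos 0<ε)
        N , qN = q (½ ℚ.* ε) (half-pos 0<ε)
    in M ⊔ N , λ n h →
      subst (0ℚ ℚ.≤_)
        (trans (solve 3 (λ a b e → (a :+ e) :+ (b :+ e) := (a :+ b) :+ (e :+ e))
                 refl (seq x n) (seq y n) (½ ℚ.* ε))
               (cong (seq x n ℚ.+ seq y n ℚ.+_) (halves ε)))
        (ℚ.+-mono-≤ (pM n (ℕ.m⊔n≤o⇒m≤o M N h)) (qN n (ℕ.m⊔n≤o⇒n≤o M N h)))

  ·-nonneg : ∀ {q x} → 0ℚ ℚ.≤ q → 0ᴿ ≤ᴿ x → 0ᴿ ≤ᴿ q · x
  ·-nonneg {q} {x} 0≤q p ε 0<ε =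
    let η , 0<η , qη≤ε = shrink q ε 0<ε
        N , pN = p η 0<η
    in N , λ n h → begin
      0ℚ                            ≡⟨ ℚ.*-zeroʳ q ⟨
      q ℚ.* 0ℚ                      ≤⟨ ℚ.*-monoˡ-≤-nonNeg q {{ℚ.nonNegative 0≤q}} (pN n h) ⟩
      q ℚ.* (seq x n ℚ.+ η)         ≡⟨ ℚ.*-distribˡ-+ q (seq x n) η ⟩
      q ℚ.* seq x n ℚ.+ q ℚ.* η     ≤⟨ ℚ.+-monoʳ-≤ (q ℚ.* seq x n)
                                         (subst (λ r → r ℚ.* η ℚ.≤ ε) (ℚ.0≤p⇒∣p∣≡p 0≤q) qη≤ε) ⟩
      q ℚ.* seq x n ℚ.+ ε           ∎
    where open ℚ.≤-Reasoning

  1-nonneg : 0ℚ ℚ.≤ 1ℚ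
  1-nonneg = ℚ.nonNegative⁻¹ 1ℚ

-- Minimum of a set of naturals, with min ∅ = ∞ (written ⊤⁺). Excluded
-- middle makes it a total function on arbitrary predicates.

IsLeast : Pred ℕ 0ℓ → ℕ → Set
IsLeast P k = P k × (∀ j → P j → k ℕ.≤ j)

least-exists : ExcludedMiddle 0ℓ → (P : Pred ℕ 0ℓ) → ∀ k → P k → ∃ (IsLeast P)
least-exists em P = <-rec (λ k → P k → ∃ (IsLeast P)) step
  where
  step : ∀ k → (∀ {j} → j ℕ.< k → P j → ∃ (IsLeast P)) → P k → ∃ (IsLeast P)
  step k rec pk with em {∃[ j ] j ℕ.< k × P j}
  ... | yes (j , j<k , pj) = rec j<k pj
  ... | no  ∄              = k , pk , λ j pj → ℕ.≮⇒≥ (λ j<k → ∄ (j , j<k , pj))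

minimum : ExcludedMiddle 0ℓ → Pred ℕ 0ℓ → ℕ ⁺
minimum em P with em {∃ P}
... | yes (k , pk) = [ proj₁ (least-exists em P k pk) ]
... | no  _        = ⊤⁺

open Strict ℕ._<_ public using () renaming (_<⁺_ to _<∞_)
open NonStrict _≤ᴿ_ public using () renaming (_≤⁺_ to _≤∞_)

fromℕ∞ : ℕ ⁺ → ℝ ⁺
fromℕ∞ = Maybe.map (λ k → fromℚ (fromℕ k))

data Walk {V : Set} (_~_ : V → V → Set) : ℕ → V → V → Set where
  []  : ∀ {v} → Walk _~_ zero v v
  _∷_ : ∀ {k u v w} → u ~ v → Walk _~_ k v w → Walk _~_ (suc k) u w

-- Connected, locally finite simple graphs.
record Graph : Set₁ where
  infix 4 _~_
  field
    V           : Set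
    _~_         : V → V → Set
    ~-sym       : ∀ {u v} → u ~ v → v ~ u
    ~-irrefl    : ∀ {v} → ¬ (v ~ v)
    _≟_         : DecidableEquality V
    nbrs        : V → List V
    nbrs-unique : ∀ v → Unique (nbrs v)
    ∈-nbrs      : ∀ {v y} → y ∈ nbrs v ⇔ (v ~ y)
    connected   : ∀ u v → ∃[ k ] Walk _~_ k u v

module _ (em : ExcludedMiddle 0ℓ) (G : Graph) where
  open Graph G

  dist : V → V → ℕ ⁺
  dist u v = minimum em (λ k → Walk _~_ k u v)

  Ball : V → ℕ → Pred V 0ℓ
  Ball ρ n u = dist u ρ <∞ [ n ]

module Toppling (G : Graph) where
  open Graph G

  record MassDistribution : Set where
    field
      mass   : V → ℝ
      nonneg : ∀ v → 0ᴿ ≤ᴿ mass v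

  open MassDistribution public

  δℚ : V → V → ℚ
  δℚ v x with v ≟ x
  ... | yes _ = 1ℚ
  ... | no  _ = 0ℚ

  private
    δℚ-nonneg : ∀ v x → 0ℚ ℚ.≤ δℚ v x
    δℚ-nonneg v x with v ≟ x
    ... | yes _ = 1-nonneg
    ... | no  _ = ℚ.≤-refl

  δ : V → MassDistribution
  δ v = record
    { mass   = λ x → fromℚ (δℚ v x)
    ; nonneg = λ x → fromℚ-nonneg (δℚ-nonneg v x)
    }

  -- 1 / |N_v|. The value at degree 0 is immaterial: it only ever
  -- multiplies an empty sum.
  1/deg : V → ℚ
  1/deg v with length (nbrs v)
  ... | zero  = 0ℚ
  ... | suc k = + 1 ℚ./ suc k

  private
    1/deg-nonneg : ∀ v → 0ℚ ℚ.≤ 1/deg v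
    1/deg-nonneg v with length (nbrs v)
    ... | zero  = ℚ.≤-refl
    ... | suc k = ℚ.nonNegative⁻¹ (+ 1 ℚ./ suc k) {{ℚ.normalize-nonNeg 1 (suc k)}}

    sum-nonneg : ∀ x ys → 0ℚ ℚ.≤ sumℚ (map (λ y → δℚ y x) ys)
    sum-nonneg x []       = ℚ.≤-refl
    sum-nonneg x (y ∷ ys) = ℚ.+-mono-≤ (δℚ-nonneg y x) (sum-nonneg x ys)

  -- Value at x of  (1 / |N_v|) Σ_{y ~ v} δ_y.
  spread : V → V → ℚ
  spread v x = 1/deg v ℚ.* sumℚ (map (λ y → δℚ y x) (nbrs v))

  private
    spread-nonneg : ∀ v x → 0ℚ ℚ.≤ spread v x
    spread-nonneg v x = subst (ℚ._≤ spread v x) (ℚ.*-zeroʳ (1/deg v))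
      (ℚ.*-monoˡ-≤-nonNeg (1/deg v) {{ℚ.nonNegative (1/deg-nonneg v)}} (sum-nonneg x (nbrs v)))

  topple : ∀ v m (μ : MassDistribution) → 0ᴿ <ᴿ m → m ≤ᴿ mass μ v → MassDistribution
  topple v m μ 0<m m≤μv = record
    { mass   = λ x → (mass μ x -ᴿ δℚ v x · m) +ᴿ spread v x · m
    ; nonneg = λ x → +-nonneg {mass μ x -ᴿ δℚ v x · m} {spread v x · m} (remains x)
        (·-nonneg {spread v x} {m} (spread-nonneg v x) (<⇒0≤ {m} 0<m))
    }
    where
    remains : ∀ x → 0ᴿ ≤ᴿ mass μ x -ᴿ δℚ v x · m
    remains x with v ≟ x
    ... | yes refl = λ ε 0<ε →
      let N , h = m≤μv ε 0<ε in
      N , λ n k →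
        subst (ℚ._≤ (seq (mass μ v) n ℚ.+ (ℚ.- 1ℚ) ℚ.* (1ℚ ℚ.* seq m n)) ℚ.+ ε)
          (ℚ.+-inverseʳ (seq m n))
          (subst (seq m n ℚ.- seq m n ℚ.≤_)
            (solve 3 (λ a b e → (a :+ e) :- b := (a :+ (:- con 1ℚ) :* (con 1ℚ :* b)) :+ e)
              refl (seq (mass μ v) n) (seq m n) ε)
            (ℚ.+-monoˡ-≤ (ℚ.- seq m n) (h n k)))
    ... | no _ = λ ε 0<ε →
      let N , h = nonneg μ x ε 0<ε in
      N , λ n k → subst (0ℚ ℚ.≤_)
        (solve 3 (λ a b e → a :+ e := (a :+ (:- con 1ℚ) :* (con 0ℚ :* b)) :+ e)
          refl (seq (mass μ x) n) (seq m n) ε)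
        (h n k)

  data Topplings : ℕ → MassDistribution → MassDistribution → Set where
    []  : ∀ {μ} → Topplings zero μ μ
    _∷_ : ∀ {k v m μ ν} (h : 0ᴿ <ᴿ m × m ≤ᴿ mass μ v) →
          Topplings k (topple v m μ (proj₁ h) (proj₂ h)) ν → Topplings (suc k) μ ν

  -- Σ_{v ∉ A} μ(v) ≥ p. The sum of nonnegative terms is the supremum of
  -- its finite partial sums, and sup ≥ p means that every q < p is
  -- exceeded by some finite partial sum.
  MassOutside≥ : Pred V 0ℓ → MassDistribution → ℝ → Set
  MassOutside≥ A μ p = ∀ q → q <ᴿ p →
    ∃[ vs ] Unique vs × All (λ v → ¬ A v) vs × q <ᴿ sumᴿ (map (mass μ) vs)

  Transportable : ℝ → Pred V 0ℓ → MassDistribution → ℕ → Set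
  Transportable p A μ₀ k = ∃[ μ ] Topplings k μ₀ μ × MassOutside≥ A μ p

Nₚ : ExcludedMiddle 0ℓ → (p : ℝ) (G : Graph) → Pred (Graph.V G) 0ℓ →
    Toppling.MassDistribution G → ℕ ⁺
Nₚ em p G A μ₀ = minimum em (Toppling.Transportable G p A μ₀)

-- The d-ary tree. A vertex is the word of child indices on the path from
-- it up to the root, which is the empty word; i ∷ v is the i-th child of v.

Child : ∀ {d} → List (Fin d) → List (Fin d) → Set
Child u v = ∃[ i ] v ≡ i ∷ u

parent : ∀ {d} → List (Fin d) → List (List (Fin d))
parent []      = []
parent (_ ∷ v) = v ∷ []

module _ (d : ℕ) where
  private
    Vertex = List (Fin d)

    _∼_ : Vertex → Vertex → Set
    u ∼ v = Child u v ⊎ Child v u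

    irrefl : ∀ {v : Vertex} → ¬ (v ∼ v)
    irrefl (inj₁ (_ , ()))
    irrefl (inj₂ (_ , ()))

    children : Vertex → List Vertex
    children v = map (_∷ v) (allFin d)

    neighbours : Vertex → List Vertex
    neighbours v = children v ++ parent v

    parent-unique : ∀ (v : Vertex) → Unique (parent v)
    parent-unique []      = []
    parent-unique (_ ∷ v) = All.[] ∷ []

    ∈-parent : ∀ {v y : Vertex} → y ∈ parent v → Child y v
    ∈-parent {i ∷ v} (here refl) = i , refl

    ∈-children : ∀ {v y : Vertex} → y ∈ children v → Child v y
    ∈-children p = let i , _ , e = ∈-map⁻ _ p in i , e

    disjoint : ∀ {v y : Vertex} → ¬ (y ∈ children v × y ∈ parent v)
    disjoint (p , q) with ∈-children p | ∈-parent q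
    ... | _ , refl | _ , ()

    unique : ∀ (v : Vertex) → Unique (neighbours v)
    unique v = Unique.++⁺ (Unique.map⁺ ∷-injectiveˡ (Unique.allFin⁺ d)) (parent-unique v) disjoint

    to : ∀ {v y : Vertex} → y ∈ neighbours v → v ∼ y
    to {v} p with ∈-++⁻ (children v) p
    ... | inj₁ q = inj₁ (∈-children q)
    ... | inj₂ q = inj₂ (∈-parent q)

    from : ∀ {v y : Vertex} → v ∼ y → y ∈ neighbours v
    from {v} (inj₁ (i , refl)) = ∈-++⁺ˡ (∈-map⁺ (_∷ v) (∈-allFin i))
    from {v} (inj₂ (i , refl)) = ∈-++⁺ʳ (children v) (here refl)

    down : ∀ {k} {u : Vertex} (v : Vertex) → Walk _∼_ k [] u → ∃[ j ] Walk _∼_ j v u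
    down []      w = _ , w
    down (i ∷ v) w = let j , w′ = down v w in suc j , inj₂ (i , refl) ∷ w′

    snoc : ∀ {k} {u v w : Vertex} → Walk _∼_ k u v → v ∼ w → Walk _∼_ (suc k) u w
    snoc []      e = e ∷ []
    snoc (f ∷ p) e = f ∷ snoc p e

    up : ∀ (v : Vertex) → ∃[ k ] Walk _∼_ k [] v
    up []      = 0 , []
    up (i ∷ v) = let k , w = up v in suc k , snoc w (inj₁ (i , refl))

  𝕋 : Graph
  𝕋 = record
    { V           = Vertex
    ; _~_         = _∼_
    ; ~-sym       = swap
    ; ~-irrefl    = irrefl
    ; _≟_         = ≡-dec Fin._≟_
    ; nbrs        = neighbours
    ; nbrs-unique = unique
    ; ∈-nbrs      = mk⇔ to from
    ; connected   = λ u v → down u (proj₂ (up v))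
    }

root : ∀ {d} → Graph.V (𝕋 d)
root = []

{-# OPTIONS --safe #-}

-- Lower bound: for superharmonic g ≥ 0 the sum Σ g(x) μ(x) never increases under toppling.
-- Taking g(x) = ι^dist(x,w) + ι^(|w|+|x|) with ι = 1/d, which is at least 1 at w and equals
-- 2 ι^|w| at the root, shows that the mass at w never exceeds 2 ι^|w|. Mass leaves the ball B_n
-- only by toppling at level n - 1, hence by at most 2 ι^(n-1) per move.
--
-- Upper bound: sweep the balls B_1, ..., B_n in turn, each of them r times, where a sweep topples
-- at every vertex of the ball the mass present at the start of the sweep. Because the walk drifts
-- outwards, a sweep of B_j multiplies Σ (3/2)^(j-|x|) μ(x), summed over B_j, by at most 17/18. For
-- r depending only on ε this sum is at most ε after every stage, so mass 1 - ε ends at level n.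
-- A ball B_j has at most d^j vertices, so at most 2 r d^n moves are made.

module Submission where

open import Defs
open import Level using (0ℓ)
open import Axiom.ExcludedMiddle using (ExcludedMiddle)
open import Algebra.Bundles using (CommutativeRing)
import Algebra.Properties.Semiring.Exp as Exp
open import Data.Empty using (⊥-elim)
open import Data.Fin.Base using (Fin)
open import Data.Integer.Base as ℤ using () renaming (+_ to pos)
import Data.Integer.Properties as ℤ
open import Data.List.Base
  using (List; []; _∷_; _++_; map; length; allFin; filter; deduplicate; cartesianProductWith)
open import Data.List.Membership.Propositional using (_∈_; _∉_)
open import Data.List.Membership.Propositional.Properties
  using (∈-map⁺; ∈-++⁺ˡ; ∈-++⁺ʳ; ∈-++⁻; ∈-allFin; ∈-filter⁺; ∈-filter⁻; ∈-deduplicate⁺;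
         ∈-cartesianProductWith⁺; ∈-cartesianProductWith⁻)
open import Data.List.Properties
  using (∷-injective; ∷-injectiveˡ; ∷-injectiveʳ; length-++; length-map; length-tabulate)
import Data.List.Relation.Unary.All as All
open All using (All; []; _∷_)
open import Data.List.Relation.Unary.Any using (here; there)
open import Data.List.Relation.Unary.AllPairs using ([]; _∷_)
open import Data.List.Relation.Unary.Unique.Propositional using (Unique)
import Data.List.Relation.Unary.Unique.Propositional.Properties as Unique
import Data.List.Relation.Unary.Unique.DecPropositional.Properties as DecUnique
import Data.List.Membership.DecPropositional as DecMembership
open import Data.Nat.Base as ℕ using (ℕ; zero; suc; _≤_; _≥_; _^_; _∸_; z≤n; s≤s)
import Data.Nat.Properties as ℕ
import Data.Nat.Coprimality as Coprime
open import Data.Product.Base using (∃; ∃-syntax; _×_; _,_; proj₁; proj₂)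
open import Data.Rational.Base as ℚ using (ℚ; 0ℚ; 1ℚ; ½; _+_; _*_; _-_; -_)
import Data.Rational.Properties as ℚ
import Data.Rational.Solver as ℚ
import Data.Rational.Unnormalised.Base as ℚᵘ
import Data.Rational.Unnormalised.Properties as ℚᵘ
open import Data.Sum.Base using (_⊎_; inj₁; inj₂)
open import Function.Base using (_∘_)
open import Function.Bundles using (Equivalence)
open import Relation.Binary.Definitions using (tri<; tri≈; tri>)
open import Relation.Binary.PropositionalEquality
  using (_≡_; _≢_; refl; sym; trans; cong; cong₂; subst; subst₂; module ≡-Reasoning)
open import Relation.Nullary using (Dec; ¬_; ¬?; yes; no)
open import Relation.Nullary.Construct.Add.Supremum using ([_])
import Relation.Binary.Construct.Add.Supremum.NonStrict as NonStrict
import Relation.Binary.Construct.Add.Supremum.Strict as Strict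
open import Relation.Unary using (Pred)

open ℚ.+-*-Solver using (solve; _:=_; _:+_; _:*_; _:-_; :-_; con)
open Exp (CommutativeRing.semiring ℚ.+-*-commutativeRing) using () renaming (_^_ to _^ℚ_)

-- The growing balls are what keeps a factor n out of the upper bound. Sweeping B_n from the start
-- would meet the weight (3/2)^n at the root, and this argument would then ask for of order n sweeps
-- of up to d^n moves each. At the start of stage j + 1, by contrast, level j carries mass at most 1
-- with weight 3/2, and the vertices above it contribute at most (3/2) ε, so the weighted sum is at
-- most 3 whatever j is.
--
-- The lower bound has to cover every sequence of moves, with real masses, on an infinite tree. No
-- infinite sum is formed: a potential is a sum over a finite list `S` that contains all toppled
-- vertices. Mass that leaves `S` can only lower it, the weights being nonnegative, so superharmonic
-- potentials still never increase. The upper bound exhibits a single sequence of moves with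
-- rational masses, which keeps its arithmetic in `ℚ`.

private
  variable
    A B : Set

-- Rational arithmetic and the embedding of the naturals.

∸-suc : ∀ {k n} → k ℕ.< n → n ∸ k ≡ suc (n ∸ suc k)
∸-suc {zero}  {suc n} _         = refl
∸-suc {suc k} {suc n} (s≤s k<n) = ∸-suc k<n

0≤1 : 0ℚ ℚ.≤ 1ℚ
0≤1 = ℚ.nonNegative⁻¹ 1ℚ

0≤q-p⇒p≤q : ∀ {p q} → 0ℚ ℚ.≤ q - p → p ℚ.≤ q
0≤q-p⇒p≤q {p} {q} h = subst₂ ℚ._≤_ (ℚ.+-identityʳ p)
  (solve 2 (λ p q → p :+ (q :- p) := q) refl p q) (ℚ.+-monoʳ-≤ p h)

p≤q⇒0≤q-p : ∀ {p q} → p ℚ.≤ q → 0ℚ ℚ.≤ q - p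
p≤q⇒0≤q-p {p} {q} h = subst (ℚ._≤ q - p) (ℚ.+-inverseʳ p) (ℚ.+-monoˡ-≤ (- p) h)

p≤p+q : ∀ {p q} → 0ℚ ℚ.≤ q → p ℚ.≤ p + q
p≤p+q {p} {q} h = subst (ℚ._≤ p + q) (ℚ.+-identityʳ p) (ℚ.+-monoʳ-≤ p h)

*-monoˡ-≤ : ∀ {p q r} → 0ℚ ℚ.≤ r → p ℚ.≤ q → r * p ℚ.≤ r * q
*-monoˡ-≤ {r = r} 0≤r = ℚ.*-monoˡ-≤-nonNeg r {{ℚ.nonNegative 0≤r}}

*-monoʳ-≤ : ∀ {p q r} → 0ℚ ℚ.≤ r → p ℚ.≤ q → p * r ℚ.≤ q * r
*-monoʳ-≤ {r = r} 0≤r = ℚ.*-monoʳ-≤-nonNeg r {{ℚ.nonNegative 0≤r}}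

*-nonneg : ∀ {p q} → 0ℚ ℚ.≤ p → 0ℚ ℚ.≤ q → 0ℚ ℚ.≤ p * q
*-nonneg {p} {q} 0≤p 0≤q = subst (ℚ._≤ p * q) (ℚ.*-zeroʳ p) (*-monoˡ-≤ 0≤p 0≤q)

^ℚ-nonneg : ∀ {p} → 0ℚ ℚ.≤ p → ∀ n → 0ℚ ℚ.≤ p ^ℚ n
^ℚ-nonneg h zero    = 0≤1
^ℚ-nonneg h (suc n) = *-nonneg h (^ℚ-nonneg h n)

fromℕ-suc : ∀ k → fromℕ (suc k) ≡ 1ℚ + fromℕ k
fromℕ-suc k rewrite ℚ.normalize-coprime {k} {0} (Coprime.sym (Coprime.1-coprimeTo k)) =
  cong (ℚ._/ 1) (cong (ℤ._+_ (pos 1)) (sym (ℤ.*-identityʳ (pos k))))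

fromℕ-+ : ∀ a b → fromℕ (a ℕ.+ b) ≡ fromℕ a + fromℕ b
fromℕ-+ zero    b = sym (ℚ.+-identityˡ (fromℕ b))
fromℕ-+ (suc a) b = trans (fromℕ-suc (a ℕ.+ b)) (trans (cong (1ℚ +_) (fromℕ-+ a b))
  (trans (sym (ℚ.+-assoc 1ℚ (fromℕ a) (fromℕ b))) (cong (_+ fromℕ b) (sym (fromℕ-suc a)))))

fromℕ-* : ∀ a b → fromℕ (a ℕ.* b) ≡ fromℕ a * fromℕ b
fromℕ-* zero    b = sym (ℚ.*-zeroˡ (fromℕ b))
fromℕ-* (suc a) b = trans (fromℕ-+ b (a ℕ.* b)) (trans (cong (fromℕ b +_) (fromℕ-* a b))
  (trans (solve 2 (λ x y → y :+ x :* y := (con 1ℚ :+ x) :* y) refl (fromℕ a) (fromℕ b))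
    (cong (_* fromℕ b) (sym (fromℕ-suc a)))))

fromℕ-^ : ∀ a n → fromℕ (a ^ n) ≡ fromℕ a ^ℚ n
fromℕ-^ a zero    = refl
fromℕ-^ a (suc n) = trans (fromℕ-* a (a ^ n)) (cong (fromℕ a *_) (fromℕ-^ a n))

fromℕ-nonneg : ∀ k → 0ℚ ℚ.≤ fromℕ k
fromℕ-nonneg zero    = ℚ.≤-refl
fromℕ-nonneg (suc k) = subst (0ℚ ℚ.≤_) (sym (fromℕ-suc k)) (ℚ.+-mono-≤ 0≤1 (fromℕ-nonneg k))

fromℕ-mono : ∀ {a b} → a ≤ b → fromℕ a ℚ.≤ fromℕ b
fromℕ-mono {b = b} z≤n = fromℕ-nonneg b
fromℕ-mono {suc a} {suc b} (s≤s h) =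
  subst₂ ℚ._≤_ (sym (fromℕ-suc a)) (sym (fromℕ-suc b)) (ℚ.+-monoʳ-≤ 1ℚ (fromℕ-mono h))

1/suc-inverse : ∀ k → (pos 1 ℚ./ suc k) * fromℕ (suc k) ≡ 1ℚ
1/suc-inverse k = ℚ.toℚᵘ-injective (ℚᵘ.≃-trans (ℚ.toℚᵘ-homo-* (pos 1 ℚ./ suc k) (fromℕ (suc k)))
  (ℚᵘ.≃-trans (ℚᵘ.*-cong (ℚ.toℚᵘ-fromℚᵘ (ℚᵘ.mkℚᵘ (pos 1) k)) (ℚ.toℚᵘ-fromℚᵘ (ℚᵘ.mkℚᵘ (pos (suc k)) 0)))
    (ℚᵘ.*≡* (trans (ℤ.*-assoc (pos 1) (pos (suc k)) (pos 1))
      (cong (ℤ._*_ (pos 1)) (sym (ℤ.pos-* (suc k) 1)))))))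

-- The denominator of `ε` serves as multiplier: the product is then the numerator, a positive
-- integer.
archimedean : ∀ {ε} → 0ℚ ℚ.< ε → ∃[ b ] 1ℚ ℚ.≤ fromℕ b * ε
archimedean {ε@(ℚ.mkℚ (pos zero) b _)} 0<ε =
  ⊥-elim (ℚ.<-irrefl {0ℚ} refl (ℚ.<-≤-trans 0<ε (ℚ.*≤* ℤ.≤-refl)))
archimedean {ε@(ℚ.mkℚ ℤ.-[1+ a ] b _)} 0<ε =
  ⊥-elim (ℚ.<-irrefl {0ℚ} refl (ℚ.<-≤-trans 0<ε (ℚ.*≤* ℤ.-≤+)))
archimedean {ε@(ℚ.mkℚ (pos (suc a)) b c)} 0<ε = suc b , subst (1ℚ ℚ.≤_) (sym eq) 1≤a
  where
  1≤a : 1ℚ ℚ.≤ fromℕ (suc a)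
  1≤a = subst (1ℚ ℚ.≤_) (sym (fromℕ-suc a)) (p≤p+q (fromℕ-nonneg a))
  eq : fromℕ (suc b) * ε ≡ fromℕ (suc a)
  eq = ℚ.toℚᵘ-injective (ℚᵘ.≃-trans (ℚ.toℚᵘ-homo-* (fromℕ (suc b)) ε)
    (ℚᵘ.≃-trans (ℚᵘ.*-cong (ℚ.toℚᵘ-fromℚᵘ (ℚᵘ.mkℚᵘ (pos (suc b)) 0)) (ℚᵘ.≃-refl {ℚ.toℚᵘ ε}))
      (ℚᵘ.≃-trans (ℚᵘ.*≡* {ℚᵘ.mkℚᵘ (pos (suc b)) 0 ℚᵘ.* ℚ.toℚᵘ ε} {ℚᵘ.mkℚᵘ (pos (suc a)) 0}
        (trans (ℤ.*-identityʳ _) (trans (ℤ.*-comm (pos (suc b)) (pos (suc a)))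
          (cong (λ x → pos (suc a) ℤ.* pos x) (sym (ℕ.+-identityʳ (suc b)))))))
        (ℚᵘ.≃-sym (ℚ.toℚᵘ-fromℚᵘ (ℚᵘ.mkℚᵘ (pos (suc a)) 0))))))

-- Finite sums of rationals.

∑ : List A → (A → ℚ) → ℚ
∑ xs f = sumℚ (map f xs)

∑-cong-∈ : ∀ (xs : List A) {f g} → (∀ {x} → x ∈ xs → f x ≡ g x) → ∑ xs f ≡ ∑ xs g
∑-cong-∈ []       h = refl
∑-cong-∈ (x ∷ xs) h = cong₂ _+_ (h (here refl)) (∑-cong-∈ xs (h ∘ there))

∑-cong : ∀ (xs : List A) {f g} → (∀ x → f x ≡ g x) → ∑ xs f ≡ ∑ xs g
∑-cong xs h = ∑-cong-∈ xs (λ {x} _ → h x)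

∑-mono : ∀ (xs : List A) {f g} → (∀ {x} → x ∈ xs → f x ℚ.≤ g x) → ∑ xs f ℚ.≤ ∑ xs g
∑-mono []       h = ℚ.≤-refl
∑-mono (x ∷ xs) h = ℚ.+-mono-≤ (h (here refl)) (∑-mono xs (h ∘ there))

∑-zero : ∀ (xs : List A) → ∑ xs (λ _ → 0ℚ) ≡ 0ℚ
∑-zero []       = refl
∑-zero (x ∷ xs) = trans (ℚ.+-identityˡ _) (∑-zero xs)

∑-nonneg : ∀ (xs : List A) {f} → (∀ x → 0ℚ ℚ.≤ f x) → 0ℚ ℚ.≤ ∑ xs f
∑-nonneg xs {f} h = subst (ℚ._≤ ∑ xs f) (∑-zero xs) (∑-mono xs (λ {x} _ → h x))

∑-+ : ∀ (xs : List A) f g → ∑ xs (λ x → f x + g x) ≡ ∑ xs f + ∑ xs g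
∑-+ []       f g = refl
∑-+ (x ∷ xs) f g = trans (cong (_+_ (f x + g x)) (∑-+ xs f g))
  (solve 4 (λ a b c d → (a :+ b) :+ (c :+ d) := (a :+ c) :+ (b :+ d)) refl
    (f x) (g x) (∑ xs f) (∑ xs g))

∑-*ˡ : ∀ (xs : List A) c f → ∑ xs (λ x → c * f x) ≡ c * ∑ xs f
∑-*ˡ []       c f = sym (ℚ.*-zeroʳ c)
∑-*ˡ (x ∷ xs) c f = trans (cong (c * f x +_) (∑-*ˡ xs c f)) (sym (ℚ.*-distribˡ-+ c (f x) (∑ xs f)))

∑-++ : ∀ (xs ys : List A) f → ∑ (xs ++ ys) f ≡ ∑ xs f + ∑ ys f
∑-++ []       ys f = sym (ℚ.+-identityˡ _)
∑-++ (x ∷ xs) ys f = trans (cong (f x +_) (∑-++ xs ys f)) (sym (ℚ.+-assoc (f x) _ _))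

∑-const : ∀ (xs : List A) c → ∑ xs (λ _ → c) ≡ fromℕ (length xs) * c
∑-const []       c = sym (ℚ.*-zeroˡ c)
∑-const (x ∷ xs) c = trans (cong (c +_) (∑-const xs c))
  (trans (solve 2 (λ c k → c :+ k :* c := (con 1ℚ :+ k) :* c) refl c (fromℕ (length xs)))
    (cong (_* c) (sym (fromℕ-suc (length xs)))))

∑-swap : ∀ (xs : List A) (ys : List B) (f : A → B → ℚ) →
  ∑ xs (λ x → ∑ ys (λ y → f x y)) ≡ ∑ ys (λ y → ∑ xs (λ x → f x y))
∑-swap []       ys f = sym (∑-zero ys)
∑-swap (x ∷ xs) ys f = trans (cong (∑ ys (f x) +_) (∑-swap xs ys f))
  (sym (∑-+ ys (f x) (λ y → ∑ xs (λ x → f x y))))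

∑-map : ∀ (h : A → B) xs f → ∑ (map h xs) f ≡ ∑ xs (f ∘ h)
∑-map h []       f = refl
∑-map h (x ∷ xs) f = cong (f (h x) +_) (∑-map h xs f)

-- Order and arithmetic of the Cauchy reals.

≤ᴿ-pointwise : ∀ {x y} → (∀ n → seq x n ℚ.≤ seq y n) → x ≤ᴿ y
≤ᴿ-pointwise h ε 0<ε = 0 , λ n _ → ℚ.≤-trans (h n) (p≤p+q (ℚ.<⇒≤ 0<ε))

≤ᴿ-refl : ∀ {x} → x ≤ᴿ x
≤ᴿ-refl {x} = ≤ᴿ-pointwise {x} {x} (λ _ → ℚ.≤-refl)

half-sum : ∀ a ε → a + ½ * ε + ½ * ε ≡ a + ε
half-sum a ε = trans (ℚ.+-assoc a (½ * ε) (½ * ε))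
  (cong (a +_) (trans (sym (ℚ.*-distribʳ-+ ε ½ ½)) (ℚ.*-identityˡ ε)))

half-pos : ∀ {ε} → 0ℚ ℚ.< ε → 0ℚ ℚ.< ½ * ε
half-pos {ε} 0<ε = subst (ℚ._< ½ * ε) (ℚ.*-zeroʳ ½) (ℚ.*-monoʳ-<-pos ½ 0<ε)

≤ᴿ-trans : ∀ {x y z} → x ≤ᴿ y → y ≤ᴿ z → x ≤ᴿ z
≤ᴿ-trans {x} {y} {z} p q ε 0<ε =
  let M , pM = p (½ * ε) (half-pos 0<ε)
      N , qN = q (½ * ε) (half-pos 0<ε)
  in M ℕ.⊔ N , λ n h → ℚ.≤-trans (pM n (ℕ.m⊔n≤o⇒m≤o M N h))
       (subst (seq y n + ½ * ε ℚ.≤_) (half-sum (seq z n) ε)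
         (ℚ.+-monoˡ-≤ (½ * ε) (qN n (ℕ.m⊔n≤o⇒n≤o M N h))))

+ᴿ-mono-≤ : ∀ {x y u v} → x ≤ᴿ y → u ≤ᴿ v → x +ᴿ u ≤ᴿ y +ᴿ v
+ᴿ-mono-≤ {x} {y} {u} {v} p q ε 0<ε =
  let M , pM = p (½ * ε) (half-pos 0<ε)
      N , qN = q (½ * ε) (half-pos 0<ε)
  in M ℕ.⊔ N , λ n h → subst (seq x n + seq u n ℚ.≤_)
       (trans (solve 3 (λ a b e → (a :+ e) :+ (b :+ e) := (a :+ b) :+ e :+ e) refl
                (seq y n) (seq v n) (½ * ε))
              (half-sum (seq y n + seq v n) ε))
       (ℚ.+-mono-≤ (pM n (ℕ.m⊔n≤o⇒m≤o M N h)) (qN n (ℕ.m⊔n≤o⇒n≤o M N h)))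

<ᴿ⇒≤ᴿ : ∀ {x y} → x <ᴿ y → x ≤ᴿ y
<ᴿ⇒≤ᴿ (η , 0<η , N , h) ε 0<ε = N , λ n k →
  ℚ.≤-trans (p≤p+q (ℚ.<⇒≤ 0<η)) (ℚ.≤-trans (h n k) (p≤p+q (ℚ.<⇒≤ 0<ε)))

·-nonneg : ∀ {q x} → 0ℚ ℚ.≤ q → 0ᴿ ≤ᴿ x → 0ᴿ ≤ᴿ q · x
·-nonneg {q} {x} 0≤q p ε 0<ε = let N , pN = p η 0<η in N , λ n h → begin
    0ℚ                     ≤⟨ *-nonneg 0≤q (pN n h) ⟩
    q * (seq x n + η)      ≡⟨ ℚ.*-distribˡ-+ q (seq x n) η ⟩
    q * seq x n + q * η    ≤⟨ ℚ.+-monoʳ-≤ (q * seq x n) qη≤ε ⟩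
    q * seq x n + ε        ∎
  where
  open ℚ.≤-Reasoning
  -- Dividing by `1 + q` instead of `q` also covers `q = 0`.
  r = 1ℚ + q
  instance
    r>0 : ℚ.Positive r
    r>0 = ℚ.positive (ℚ.<-≤-trans (ℚ.positive⁻¹ 1ℚ) (p≤p+q 0≤q))
    r≢0 : ℚ.NonZero r
    r≢0 = ℚ.pos⇒nonZero r
    1/r>0 : ℚ.Positive (ℚ.1/ r)
    1/r>0 = ℚ.1/pos⇒pos r
    ε>0 : ℚ.Positive ε
    ε>0 = ℚ.positive 0<ε
  η = ℚ.1/ r * ε
  0<η : 0ℚ ℚ.< η
  0<η = ℚ.positive⁻¹ η {{ℚ.pos*pos⇒pos (ℚ.1/ r) ε}}
  qη≤ε : q * η ℚ.≤ ε
  qη≤ε = begin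
    q * η              ≤⟨ *-monoʳ-≤ (ℚ.<⇒≤ 0<η) (subst (q ℚ.≤_) (ℚ.+-comm q 1ℚ) (p≤p+q 0≤1)) ⟩
    r * (ℚ.1/ r * ε)   ≡⟨ ℚ.*-assoc r (ℚ.1/ r) ε ⟨
    r * ℚ.1/ r * ε     ≡⟨ cong (_* ε) (ℚ.*-inverseʳ r) ⟩
    1ℚ * ε             ≡⟨ ℚ.*-identityˡ ε ⟩
    ε                  ∎

+ᴿ-nonneg : ∀ {x y} → 0ᴿ ≤ᴿ x → 0ᴿ ≤ᴿ y → 0ᴿ ≤ᴿ x +ᴿ y
+ᴿ-nonneg {x} {y} p q = +ᴿ-mono-≤ {0ᴿ} {x} {0ᴿ} {y} p q

x≤x+y : ∀ {x y} → 0ᴿ ≤ᴿ y → x ≤ᴿ x +ᴿ y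
x≤x+y {x} {y} p = ≤ᴿ-trans {x} {x +ᴿ 0ᴿ} {x +ᴿ y}
  (≤ᴿ-pointwise {x} {x +ᴿ 0ᴿ} (λ n → ℚ.≤-reflexive (sym (ℚ.+-identityʳ (seq x n)))))
  (+ᴿ-mono-≤ {x} {x} {0ᴿ} {y} (≤ᴿ-refl {x}) p)

-- Entries of the sequence `x` may be negative even though `x` is nonnegative as a real, so
-- entrywise comparison fails; the nonnegative real `(q - p) · x` is added instead.
·-monoˡ-≤ : ∀ {p q x} → p ℚ.≤ q → 0ᴿ ≤ᴿ x → p · x ≤ᴿ q · x
·-monoˡ-≤ {p} {q} {x} p≤q 0≤x = ≤ᴿ-trans {p · x} {p · x +ᴿ (q - p) · x} {q · x}
  (x≤x+y {p · x} {(q - p) · x} (·-nonneg {q - p} {x} (p≤q⇒0≤q-p p≤q) 0≤x))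
  (≤ᴿ-pointwise {p · x +ᴿ (q - p) · x} {q · x} (λ n → ℚ.≤-reflexive
    (solve 3 (λ p q x → p :* x :+ (q :- p) :* x := q :* x) refl p q (seq x n))))

seq-sumᴿ : ∀ (F : A → ℝ) xs n → seq (sumᴿ (map F xs)) n ≡ ∑ xs (λ x → seq (F x) n)
seq-sumᴿ F []       n = refl
seq-sumᴿ F (x ∷ xs) n = cong (seq (F x) n +_) (seq-sumᴿ F xs n)

sumᴿ-nonneg : ∀ (F : A → ℝ) xs → (∀ x → 0ᴿ ≤ᴿ F x) → 0ᴿ ≤ᴿ sumᴿ (map F xs)
sumᴿ-nonneg F []       h = ≤ᴿ-refl {0ᴿ}
sumᴿ-nonneg F (x ∷ xs) h = +ᴿ-nonneg {F x} {sumᴿ (map F xs)} (h x) (sumᴿ-nonneg F xs h)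

<ᴿ-≤ᴿ-fromℚ : ∀ {p x q} → fromℚ p <ᴿ x → x ≤ᴿ fromℚ q → p ℚ.≤ q
<ᴿ-≤ᴿ-fromℚ {p} {x} {q} (ε , 0<ε , M , h) k =
  let N , kN = k ε 0<ε
      n = M ℕ.⊔ N
  in subst₂ ℚ._≤_ (cancel p ε) (cancel q ε)
       (ℚ.+-monoˡ-≤ (- ε) (ℚ.≤-trans (h n (ℕ.m≤m⊔n M N)) (kN n (ℕ.m≤n⊔m M N))))
  where
  cancel : ∀ a ε → a + ε - ε ≡ a
  cancel = solve 2 (λ a ε → a :+ ε :- ε := a) refl

≤ᴿ⇒≤ : ∀ {p q} → fromℚ p ≤ᴿ fromℚ q → p ℚ.≤ q
≤ᴿ⇒≤ {p} {q} h = ℚ.≮⇒≥ (λ q<p →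
  let ε = ½ * (p - q)
      0<ε = half-pos (subst (ℚ._< p - q) (ℚ.+-inverseʳ q) (ℚ.+-monoˡ-< (- q) q<p))
      N , k = h ε 0<ε
  in ℚ.<-irrefl refl (ℚ.<-≤-trans
       (subst₂ ℚ._<_ (ℚ.+-identityʳ (q + ε))
         (trans (half-sum q (p - q)) (solve 2 (λ p q → q :+ (p :- q) := p) refl p q))
         (ℚ.+-monoʳ-< (q + ε) 0<ε))
       (k N ℕ.≤-refl)))

<ᴿ-≤ᴿ-trans : ∀ {x y z} → x <ᴿ y → y ≤ᴿ z → x <ᴿ z
<ᴿ-≤ᴿ-trans {x} {y} {z} (ε , 0<ε , M , h) k =
  let N , kN = k (½ * ε) (half-pos 0<ε)
  in ½ * ε , half-pos 0<ε , M ℕ.⊔ N , λ n l → subst₂ ℚ._≤_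
       (trans (cong (_- ½ * ε) (sym (half-sum (seq x n) ε)))
         (solve 2 (λ a b → a :+ b :+ b :- b := a :+ b) refl (seq x n) (½ * ε)))
       (solve 2 (λ a b → a :+ b :- b := a) refl (seq z n) (½ * ε))
       (ℚ.+-monoˡ-≤ (- (½ * ε)) (ℚ.≤-trans (h n (ℕ.m⊔n≤o⇒m≤o M N l)) (kN n (ℕ.m⊔n≤o⇒n≤o M N l))))

-- Minima of sets of naturals.

minimum-≤ : ∀ (em : ExcludedMiddle 0ℓ) (P : Pred ℕ 0ℓ) k → P k →
  ∃[ j ] minimum em P ≡ [ j ] × P j × j ≤ k
minimum-≤ em P k pk with em {∃ P}
... | yes (i , pi) =
  let j , pj , least = least-exists em P i pi in j , refl , pj , least k pk
... | no ∄         = ⊥-elim (∄ (k , pk))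

minimum-<∞ : ∀ (em : ExcludedMiddle 0ℓ) (P : Pred ℕ 0ℓ) n → minimum em P <∞ [ n ] → ∃[ j ] P j × j ℕ.< n
minimum-<∞ em P n h with em {∃ P}
minimum-<∞ em P n Strict.[ j<n ] | yes (i , pi) =
  let j , pj , _ = least-exists em P i pi in j , pj , j<n

-- Potentials on a graph and their change under one toppling.

module _ (G : Graph) where
  open Graph G
  open Toppling G
  open DecMembership _≟_ using (_∈?_)

  δℚ-same : ∀ v → δℚ v v ≡ 1ℚ
  δℚ-same v with v ≟ v
  ... | yes _   = refl
  ... | no v≢v = ⊥-elim (v≢v refl)

  δℚ-diff : ∀ {v x} → v ≢ x → δℚ v x ≡ 0ℚ
  δℚ-diff {v} {x} v≢x with v ≟ x
  ... | yes v≡x = ⊥-elim (v≢x v≡x)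
  ... | no _    = refl

  δℚ-nonneg : ∀ v x → 0ℚ ℚ.≤ δℚ v x
  δℚ-nonneg v x with v ≟ x
  ... | yes _ = 0≤1
  ... | no _  = ℚ.≤-refl

  1/deg-nonneg : ∀ v → 0ℚ ℚ.≤ 1/deg v
  1/deg-nonneg v with length (nbrs v)
  ... | zero  = ℚ.≤-refl
  ... | suc k = ℚ.nonNegative⁻¹ (pos 1 ℚ./ suc k) {{ℚ.normalize-nonNeg 1 (suc k)}}

  1/deg-inverse : ∀ v → 1 ≤ length (nbrs v) → 1/deg v * fromℕ (length (nbrs v)) ≡ 1ℚ
  1/deg-inverse v _ with length (nbrs v)
  1/deg-inverse v () | zero
  1/deg-inverse v _  | suc k = 1/suc-inverse k

  spread-nonneg : ∀ v x → 0ℚ ℚ.≤ spread v x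
  spread-nonneg v x = *-nonneg (1/deg-nonneg v) (∑-nonneg (nbrs v) (λ y → δℚ-nonneg y x))

  gain : V → V → ℚ
  gain v x = spread v x - δℚ v x

  -- The generator of simple random walk, which is also the rate at which the sum of `g x * μ x`
  -- changes per unit of mass toppled at `v`.
  Δ : (V → ℚ) → V → ℚ
  Δ g v = 1/deg v * ∑ (nbrs v) g - g v

  Φ : List V → (V → ℚ) → (V → ℚ) → ℚ
  Φ S g f = ∑ S (λ x → g x * f x)

  Φ-δ-∉ : ∀ {S y} g → y ∉ S → Φ S g (δℚ y) ≡ 0ℚ
  Φ-δ-∉ {[]}    g y∉S = refl
  Φ-δ-∉ {x ∷ S} g y∉S =
    cong₂ _+_ (trans (cong (g x *_) (δℚ-diff (y∉S ∘ here))) (ℚ.*-zeroʳ (g x)))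
              (Φ-δ-∉ {S} g (y∉S ∘ there))

  Φ-δ-∈ : ∀ {S y} g → Unique S → y ∈ S → Φ S g (δℚ y) ≡ g y
  Φ-δ-∈ {x ∷ S} g (x∉S ∷ _) (here refl) = trans
    (cong₂ _+_ (trans (cong (g x *_) (δℚ-same x)) (ℚ.*-identityʳ (g x)))
               (Φ-δ-∉ {S} g (λ x∈S → All.lookup x∉S x∈S refl)))
    (ℚ.+-identityʳ (g x))
  Φ-δ-∈ {x ∷ S} {y} g (x∉S ∷ u) (there y∈S) = trans
    (cong₂ _+_ (trans (cong (g x *_) (δℚ-diff (λ y≡x → All.lookup x∉S y∈S (sym y≡x))))
                      (ℚ.*-zeroʳ (g x)))
               (Φ-δ-∈ g u y∈S))
    (ℚ.+-identityˡ (g y))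

  Φ-δ-≤ : ∀ {S y} g → Unique S → 0ℚ ℚ.≤ g y → Φ S g (δℚ y) ℚ.≤ g y
  Φ-δ-≤ {S} {y} g u 0≤gy with y ∈? S
  ... | yes y∈S = ℚ.≤-reflexive (Φ-δ-∈ g u y∈S)
  ... | no y∉S  = subst (ℚ._≤ g y) (sym (Φ-δ-∉ g y∉S)) 0≤gy

  Φ-move : ∀ S g f m k → Φ S g (λ x → f x + m * k x) ≡ Φ S g f + m * Φ S g k
  Φ-move S g f m k = trans
    (∑-cong S (λ x → solve 4 (λ g f m k → g :* (f :+ m :* k) := g :* f :+ m :* (g :* k)) refl
      (g x) (f x) m (k x)))
    (trans (∑-+ S (λ x → g x * f x) (λ x → m * (g x * k x)))
      (cong (Φ S g f +_) (∑-*ˡ S m (λ x → g x * k x))))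

  Φ-gain : ∀ S g v →
    Φ S g (gain v) ≡ 1/deg v * ∑ (nbrs v) (λ y → Φ S g (δℚ y)) - Φ S g (δℚ v)
  Φ-gain S g v = begin
    Φ S g (gain v)
      ≡⟨ ∑-cong S (λ x → solve 4 (λ g c s d → g :* (c :* s :- d) := c :* (g :* s) :+ (:- con 1ℚ) :* (g :* d))
           refl (g x) c (∑ ys (λ y → δℚ y x)) (δℚ v x)) ⟩
    ∑ S (λ x → c * (g x * ∑ ys (λ y → δℚ y x)) + - 1ℚ * (g x * δℚ v x))
      ≡⟨ ∑-+ S _ _ ⟩
    ∑ S (λ x → c * (g x * ∑ ys (λ y → δℚ y x))) + ∑ S (λ x → - 1ℚ * (g x * δℚ v x))
      ≡⟨ cong₂ _+_ (∑-*ˡ S c _) (∑-*ˡ S (- 1ℚ) _) ⟩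
    c * ∑ S (λ x → g x * ∑ ys (λ y → δℚ y x)) + - 1ℚ * Φ S g (δℚ v)
      ≡⟨ cong (λ s → c * s + - 1ℚ * Φ S g (δℚ v)) (trans
           (∑-cong S (λ x → sym (∑-*ˡ ys (g x) (λ y → δℚ y x))))
           (∑-swap S ys (λ x y → g x * δℚ y x))) ⟩
    c * ∑ ys (λ y → Φ S g (δℚ y)) + - 1ℚ * Φ S g (δℚ v)
      ≡⟨ solve 2 (λ a b → a :+ (:- con 1ℚ) :* b := a :- b) refl
           (c * ∑ ys (λ y → Φ S g (δℚ y))) (Φ S g (δℚ v)) ⟩
    c * ∑ ys (λ y → Φ S g (δℚ y)) - Φ S g (δℚ v) ∎
    where
    open ≡-Reasoning
    c = 1/deg v
    ys = nbrs v

  -- Mass sent to neighbours outside `S` drops out of the sum, which lowers it because `g` is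
  -- nonnegative. The vertex `v` has to lie in `S`, since otherwise the loss there would not be
  -- counted.
  Φ-gain-≤ : ∀ {S v g} → Unique S → v ∈ S → (∀ x → 0ℚ ℚ.≤ g x) → Φ S g (gain v) ℚ.≤ Δ g v
  Φ-gain-≤ {S} {v} {g} u v∈S 0≤g = subst₂ ℚ._≤_ (sym (Φ-gain S g v))
    (cong (λ a → 1/deg v * ∑ (nbrs v) g - a) (Φ-δ-∈ g u v∈S))
    (ℚ.+-monoˡ-≤ (- Φ S g (δℚ v)) (*-monoˡ-≤ (1/deg-nonneg v)
      (∑-mono (nbrs v) (λ {y} _ → Φ-δ-≤ g u (0≤g y)))))

  -- With all neighbours in `S` nothing drops out, whatever the sign of `g`. Together with
  -- `Φ-gain-≤` this yields conservation of mass for the constant 1.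
  Φ-gain-≥ : ∀ {S v g} → Unique S → v ∈ S → All (_∈ S) (nbrs v) → Δ g v ℚ.≤ Φ S g (gain v)
  Φ-gain-≥ {S} {v} {g} u v∈S n∈S = subst₂ ℚ._≤_
    (cong (λ a → 1/deg v * ∑ (nbrs v) g - a) (Φ-δ-∈ g u v∈S)) (sym (Φ-gain S g v))
    (ℚ.+-monoˡ-≤ (- Φ S g (δℚ v)) (*-monoˡ-≤ (1/deg-nonneg v)
      (∑-mono (nbrs v) (λ y∈ → ℚ.≤-reflexive (sym (Φ-δ-∈ g u (All.lookup n∈S y∈)))))))

  opaque
    potential : List V → (V → ℚ) → MassDistribution → ℝ
    potential S g μ = sumᴿ (map (λ x → g x · mass μ x) S)

  gain-seq : ∀ v m μ (p : 0ᴿ <ᴿ m) (q : m ≤ᴿ mass μ v) x n →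
    seq (mass (topple v m μ p q) x) n ≡ seq (mass μ x) n + seq m n * gain v x
  gain-seq v m μ p q x n = solve 4
    (λ a m s d → (a :+ (:- con 1ℚ) :* (d :* m)) :+ s :* m := a :+ m :* (s :- d)) refl
    (seq (mass μ x) n) (seq m n) (spread v x) (δℚ v x)

  opaque
    unfolding potential

    seq-potential : ∀ S g μ n → seq (potential S g μ) n ≡ Φ S g (λ x → seq (mass μ x) n)
    seq-potential S g μ n = seq-sumᴿ (λ x → g x · mass μ x) S n

  -- Recorded entry by entry and not up to `_≤ᴿ_`, so that linear identities can be computed over
  -- `ℚ` at each index.
  Toppled : V → ℝ → MassDistribution → MassDistribution → Set
  Toppled v m μ μ′ = ∀ x n → seq (mass μ′ x) n ≡ seq (mass μ x) n + seq m n * gain v x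

  potential-topple : ∀ {S g v m μ μ′ κ} → 0ᴿ <ᴿ m → Toppled v m μ μ′ → Φ S g (gain v) ℚ.≤ κ →
    potential S g μ′ ≤ᴿ potential S g μ +ᴿ κ · m
  potential-topple {S} {g} {v} {m} {μ} {μ′} {κ} 0<m t K≤κ =
    ≤ᴿ-trans {potential S g μ′} {potential S g μ +ᴿ K · m} {potential S g μ +ᴿ κ · m}
      (≤ᴿ-pointwise {potential S g μ′} {potential S g μ +ᴿ K · m}
        (λ n → ℚ.≤-reflexive (begin
          seq (potential S g μ′) n
            ≡⟨ seq-potential S g μ′ n ⟩
          Φ S g (λ x → seq (mass μ′ x) n)
            ≡⟨ ∑-cong S (λ x → cong (g x *_) (t x n)) ⟩
          Φ S g (λ x → seq (mass μ x) n + seq m n * gain v x)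
            ≡⟨ Φ-move S g (λ x → seq (mass μ x) n) (seq m n) (gain v) ⟩
          Φ S g (λ x → seq (mass μ x) n) + seq m n * K
            ≡⟨ cong₂ _+_ (sym (seq-potential S g μ n)) (ℚ.*-comm (seq m n) K) ⟩
          seq (potential S g μ) n + K * seq m n ∎)))
      (+ᴿ-mono-≤ {potential S g μ} {potential S g μ} {K · m} {κ · m} (≤ᴿ-refl {potential S g μ})
        (·-monoˡ-≤ {K} {κ} {m} K≤κ (<ᴿ⇒≤ᴿ {0ᴿ} {m} 0<m)))
    where
    open ≡-Reasoning
    K = Φ S g (gain v)

  potential-topple-≤ : ∀ {S g v m μ μ′} → 0ᴿ <ᴿ m → Toppled v m μ μ′ → Φ S g (gain v) ℚ.≤ 0ℚ →
    potential S g μ′ ≤ᴿ potential S g μ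
  potential-topple-≤ {S} {g} {v} {m} {μ} {μ′} 0<m t K≤0 =
    ≤ᴿ-trans {potential S g μ′} {potential S g μ +ᴿ 0ℚ · m} {potential S g μ}
      (potential-topple {S} {g} {v} {m} {μ} {μ′} 0<m t K≤0)
      (≤ᴿ-pointwise {potential S g μ +ᴿ 0ℚ · m} {potential S g μ} (λ n → ℚ.≤-reflexive
        (solve 2 (λ a m → a :+ con 0ℚ :* m := a) refl (seq (potential S g μ) n) (seq m n))))

  potential-δ : ∀ {S g ρ} → Unique S → 0ℚ ℚ.≤ g ρ → potential S g (δ ρ) ≤ᴿ fromℚ (g ρ)
  potential-δ {S} {g} {ρ} u 0≤gρ = ≤ᴿ-pointwise {potential S g (δ ρ)} {fromℚ (g ρ)} (λ n →
    subst (ℚ._≤ g ρ) (sym (seq-potential S g (δ ρ) n)) (Φ-δ-≤ g u 0≤gρ))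

  mass≤· : ∀ {q} μ x → 1ℚ ℚ.≤ q → mass μ x ≤ᴿ q · mass μ x
  mass≤· {q} μ x 1≤q = ≤ᴿ-trans {mass μ x} {1ℚ · mass μ x} {q · mass μ x}
    (≤ᴿ-pointwise {mass μ x} {1ℚ · mass μ x} (λ n → ℚ.≤-reflexive (sym (ℚ.*-identityˡ _))))
    (·-monoˡ-≤ {1ℚ} {q} {mass μ x} 1≤q (nonneg μ x))

  opaque
    unfolding potential

    potential-nonneg : ∀ S {g} μ → (∀ x → 0ℚ ℚ.≤ g x) → 0ᴿ ≤ᴿ potential S g μ
    potential-nonneg S {g} μ 0≤g =
      sumᴿ-nonneg (λ x → g x · mass μ x) S (λ x → ·-nonneg {g x} {mass μ x} (0≤g x) (nonneg μ x))

    sum-mass≤potential : ∀ vs {ws g} μ → (∀ x → 0ℚ ℚ.≤ g x) → All (λ v → 1ℚ ℚ.≤ g v) vs →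
      sumᴿ (map (mass μ) vs) ≤ᴿ potential (vs ++ ws) g μ
    sum-mass≤potential []       {ws} μ 0≤g []        = potential-nonneg ws μ 0≤g
    sum-mass≤potential (v ∷ vs) {ws} {g} μ 0≤g (h ∷ hs) =
      +ᴿ-mono-≤ {mass μ v} {g v · mass μ v} {sumᴿ (map (mass μ) vs)} {potential (vs ++ ws) g μ}
        (mass≤· {g v} μ v h) (sum-mass≤potential vs {ws} μ 0≤g hs)

    mass≤potential : ∀ {S g v} μ → (∀ x → 0ℚ ℚ.≤ g x) → 1ℚ ℚ.≤ g v → v ∈ S →
      mass μ v ≤ᴿ potential S g μ
    mass≤potential {x ∷ S} {g} {v} μ 0≤g h (here refl) =
      ≤ᴿ-trans {mass μ v} {g v · mass μ v} {potential (x ∷ S) g μ} (mass≤· {g v} μ v h)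
        (x≤x+y {g v · mass μ v} {potential S g μ} (potential-nonneg S μ 0≤g))
    mass≤potential {x ∷ S} {g} {v} μ 0≤g h (there v∈S) =
      ≤ᴿ-trans {mass μ v} {0ᴿ +ᴿ mass μ v} {potential (x ∷ S) g μ}
        (≤ᴿ-pointwise {mass μ v} {0ᴿ +ᴿ mass μ v} (λ n → ℚ.≤-reflexive (sym (ℚ.+-identityˡ _))))
        (+ᴿ-mono-≤ {0ᴿ} {g x · mass μ x} {mass μ v} {potential S g μ}
          (·-nonneg {g x} {mass μ x} (0≤g x) (nonneg μ x)) (mass≤potential μ 0≤g h v∈S))

  -- The cost of transport, bounded below by superharmonic functions.

  Superharmonic : (V → ℚ) → Set
  Superharmonic g = (∀ x → 0ℚ ℚ.≤ g x) × (∀ v → Δ g v ℚ.≤ 0ℚ)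

  -- B bounds the mass that can ever sit at a vertex where toppling increases
  -- the h-potential: superharmonic potentials never increase.
  module _ {ρ : V} {h : V → ℚ} {B : ℚ} (0≤h : ∀ x → 0ℚ ℚ.≤ h x) (0≤B : 0ℚ ℚ.≤ B)
    (control : ∀ v → Δ h v ℚ.≤ 0ℚ ⊎
      Δ h v ℚ.≤ 1ℚ × ∃[ g ] Superharmonic g × 1ℚ ℚ.≤ g v × g ρ ℚ.≤ B)
    where

    -- One list `S` must serve a whole run, and it can be fixed only when all toppled vertices and
    -- the vertices witnessing the final mass are known; hence `S` is quantified inside, after `ts`.
    -- The hypothesis on superharmonic `g` is the invariant that each toppling passes on.
    Growth : ℕ → MassDistribution → MassDistribution → List V → Set
    Growth k μ ν ts = ∀ S → Unique S → All (_∈ S) ts →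
      (∀ g → Superharmonic g → potential S g μ ≤ᴿ fromℚ (g ρ)) →
      potential S h ν ≤ᴿ potential S h μ +ᴿ fromℚ (fromℕ k * B)

    growth-[] : ∀ μ → Growth 0 μ μ []
    growth-[] μ S _ _ _ = x≤x+y {potential S h μ} {fromℚ (fromℕ 0 * B)}
      (≤ᴿ-pointwise {0ᴿ} {fromℚ (fromℕ 0 * B)} (λ _ → *-nonneg {0ℚ} ℚ.≤-refl 0≤B))

    growth-∷ : ∀ {k v m μ μ′ ν ts} → 0ᴿ <ᴿ m → m ≤ᴿ mass μ v → Toppled v m μ μ′ →
      Growth k μ′ ν ts → Growth (suc k) μ ν (v ∷ ts)
    growth-∷ {k} {v} {m} {μ} {μ′} {ν} p q t rest S u (v∈S ∷ ts⊆S) bounded =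
      ≤ᴿ-trans {potential S h ν} {potential S h μ′ +ᴿ fromℚ (fromℕ k * B)}
        {potential S h μ +ᴿ fromℚ (fromℕ (suc k) * B)}
        (rest S u ts⊆S bounded′)
        (≤ᴿ-trans {potential S h μ′ +ᴿ fromℚ (fromℕ k * B)}
          {(potential S h μ +ᴿ fromℚ B) +ᴿ fromℚ (fromℕ k * B)}
          {potential S h μ +ᴿ fromℚ (fromℕ (suc k) * B)}
          (+ᴿ-mono-≤ {potential S h μ′} {potential S h μ +ᴿ fromℚ B}
            {fromℚ (fromℕ k * B)} {fromℚ (fromℕ k * B)}
            (one-step (control v)) (≤ᴿ-refl {fromℚ (fromℕ k * B)}))
          (≤ᴿ-pointwise {(potential S h μ +ᴿ fromℚ B) +ᴿ fromℚ (fromℕ k * B)}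
            {potential S h μ +ᴿ fromℚ (fromℕ (suc k) * B)} (λ n → ℚ.≤-reflexive (trans
              (solve 3 (λ a b k → a :+ b :+ k :* b := a :+ (con 1ℚ :+ k) :* b) refl
                (seq (potential S h μ) n) B (fromℕ k))
              (cong (λ j → seq (potential S h μ) n + j * B) (sym (fromℕ-suc k)))))))
      where
      bounded′ : ∀ g → Superharmonic g → potential S g μ′ ≤ᴿ fromℚ (g ρ)
      bounded′ g sup@(0≤g , Δg≤0) = ≤ᴿ-trans {potential S g μ′} {potential S g μ} {fromℚ (g ρ)}
        (potential-topple-≤ {S} {g} {v} {m} {μ} {μ′} p t
          (ℚ.≤-trans (Φ-gain-≤ u v∈S 0≤g) (Δg≤0 v)))
        (bounded g sup)
      one-step : _ → potential S h μ′ ≤ᴿ potential S h μ +ᴿ fromℚ B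
      one-step (inj₁ Δh≤0) = ≤ᴿ-trans {potential S h μ′} {potential S h μ} {potential S h μ +ᴿ fromℚ B}
        (potential-topple-≤ {S} {h} {v} {m} {μ} {μ′} p t
          (ℚ.≤-trans (Φ-gain-≤ u v∈S 0≤h) Δh≤0))
        (x≤x+y {potential S h μ} {fromℚ B} (≤ᴿ-pointwise {0ᴿ} {fromℚ B} (λ _ → 0≤B)))
      -- The toppled `m` is at most the mass at `v`; since `1 ≤ g v`, that is at most the
      -- `g`-potential, hence at most `g ρ ≤ B`.
      one-step (inj₂ (Δh≤1 , g , sup@(0≤g , _) , 1≤gv , gρ≤B)) =
        ≤ᴿ-trans {potential S h μ′} {potential S h μ +ᴿ 1ℚ · m} {potential S h μ +ᴿ fromℚ B}
          (potential-topple {S} {h} {v} {m} {μ} {μ′} p t (ℚ.≤-trans (Φ-gain-≤ u v∈S 0≤h) Δh≤1))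
          (+ᴿ-mono-≤ {potential S h μ} {potential S h μ} {1ℚ · m} {fromℚ B}
            (≤ᴿ-refl {potential S h μ})
            (≤ᴿ-trans {1ℚ · m} {m} {fromℚ B}
              (≤ᴿ-pointwise {1ℚ · m} {m} (λ n → ℚ.≤-reflexive (ℚ.*-identityˡ (seq m n))))
              (≤ᴿ-trans {m} {mass μ v} {fromℚ B} q
                (≤ᴿ-trans {mass μ v} {potential S g μ} {fromℚ B}
                  (mass≤potential μ 0≤g 1≤gv v∈S)
                  (≤ᴿ-trans {potential S g μ} {fromℚ (g ρ)} {fromℚ B} (bounded g sup)
                    (≤ᴿ-pointwise {fromℚ (g ρ)} {fromℚ B} (λ _ → gρ≤B)))))))

    growth : ∀ {k μ ν} → Topplings k μ ν → ∃ (Growth k μ ν)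
    growth {μ = μ} [] = [] , growth-[] μ
    growth {suc k} {μ} {ν} (_∷_ {v = v} {m = m} (p , q) t) =
      let ts , rest = growth t in
      v ∷ ts , growth-∷ {k} {v} {m} {μ} {topple v m μ p q} {ν} {ts} p q (gain-seq v m μ p q) rest

    -- The `h`-potential starts at most 0, ends at no less than the mass found outside `A`, and
    -- rises by at most `B` per move.
    transport-cost : ∀ {A p q k} → (∀ v → ¬ A v → 1ℚ ℚ.≤ h v) → h ρ ℚ.≤ 0ℚ →
      fromℚ q <ᴿ p → Transportable p A (δ ρ) k → q ℚ.≤ fromℕ k * B
    transport-cost {q = q} {k} 1≤h hρ≤0 q<p (ν , t , out)
      with vs , unique-vs , vs∌A , q<sum ← out (fromℚ q) q<p =
      <ᴿ-≤ᴿ-fromℚ {q} {sumᴿ (map (mass ν) vs)} {fromℕ k * B} q<sum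
        (≤ᴿ-trans {sumᴿ (map (mass ν) vs)} {potential S h ν} {fromℚ (fromℕ k * B)}
          (sum-mass≤potential vs {ws} ν 0≤h (All.map (λ {v} → 1≤h v) vs∌A))
          (≤ᴿ-trans {potential S h ν} {potential S h (δ ρ) +ᴿ fromℚ (fromℕ k * B)}
            {fromℚ (fromℕ k * B)}
            (proj₂ (growth t) S unique-S (All.tabulate toppled∈S)
              (λ g sup → potential-δ {S} {g} unique-S (proj₁ sup ρ)))
            (≤ᴿ-trans {potential S h (δ ρ) +ᴿ fromℚ (fromℕ k * B)}
              {0ᴿ +ᴿ fromℚ (fromℕ k * B)} {fromℚ (fromℕ k * B)}
              (+ᴿ-mono-≤ {potential S h (δ ρ)} {0ᴿ} {fromℚ (fromℕ k * B)} {fromℚ (fromℕ k * B)}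
                (≤ᴿ-trans {potential S h (δ ρ)} {fromℚ (h ρ)} {0ᴿ}
                  (potential-δ {S} {h} unique-S (0≤h ρ))
                  (≤ᴿ-pointwise {fromℚ (h ρ)} {0ᴿ} (λ _ → hρ≤0)))
                (≤ᴿ-refl {fromℚ (fromℕ k * B)}))
              (≤ᴿ-pointwise {0ᴿ +ᴿ fromℚ (fromℕ k * B)} {fromℚ (fromℕ k * B)}
                (λ _ → ℚ.≤-reflexive (ℚ.+-identityˡ _))))))
      where
      toppled : List V
      toppled = proj₁ (growth t)
      fresh : List V
      fresh = deduplicate _≟_ toppled
      -- The toppled vertices not yet in `vs`. Putting `vs` first in `S` allows the outside mass to
      -- be compared with the potential along a prefix.
      ws : List V
      ws = filter (λ v → ¬? (v ∈? vs)) fresh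
      S : List V
      S = vs ++ ws
      unique-S : Unique S
      unique-S = Unique.++⁺ unique-vs (Unique.filter⁺ _ (DecUnique.deduplicate-! _≟_ toppled))
        (λ (v∈vs , v∈ws) → proj₂ (∈-filter⁻ _ {xs = fresh} v∈ws) v∈vs)
      toppled∈S : ∀ {v} → v ∈ toppled → v ∈ S
      toppled∈S {v} v∈t with v ∈? vs
      ... | yes v∈vs = ∈-++⁺ˡ v∈vs
      ... | no v∉vs  = ∈-++⁺ʳ vs (∈-filter⁺ (λ v → ¬? (v ∈? vs)) (∈-deduplicate⁺ _≟_ v∈t) v∉vs)

  -- The Laplacian.

  Δ-≤ : ∀ {g v b} → 1 ≤ length (nbrs v) → (∀ {y} → y ∈ nbrs v → g y ℚ.≤ b) → Δ g v ℚ.≤ b - g v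
  Δ-≤ {g} {v} {b} 1≤deg h = ℚ.+-monoˡ-≤ (- g v) (begin
    1/deg v * ∑ (nbrs v) g                       ≤⟨ *-monoˡ-≤ (1/deg-nonneg v) (∑-mono (nbrs v) h) ⟩
    1/deg v * ∑ (nbrs v) (λ _ → b)               ≡⟨ cong (1/deg v *_) (∑-const (nbrs v) b) ⟩
    1/deg v * (fromℕ (length (nbrs v)) * b)      ≡⟨ ℚ.*-assoc (1/deg v) _ b ⟨
    1/deg v * fromℕ (length (nbrs v)) * b        ≡⟨ cong (_* b) (1/deg-inverse v 1≤deg) ⟩
    1ℚ * b                                       ≡⟨ ℚ.*-identityˡ b ⟩
    b                                            ∎)
    where open ℚ.≤-Reasoning

  -- `Δ` multiplied by the degree: computations on the tree then need no division, and `Δ-Lap`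
  -- returns to `Δ`.
  Lap : (V → ℚ) → V → ℚ
  Lap g v = ∑ (nbrs v) g - fromℕ (length (nbrs v)) * g v

  Δ-Lap : ∀ g {v} → 1 ≤ length (nbrs v) → Δ g v ≡ 1/deg v * Lap g v
  Δ-Lap g {v} 1≤deg = begin
    c * s - g v                    ≡⟨ cong (λ a → c * s - a) (ℚ.*-identityˡ (g v)) ⟨
    c * s - 1ℚ * g v               ≡⟨ cong (λ a → c * s - a * g v) (1/deg-inverse v 1≤deg) ⟨
    c * s - c * k * g v            ≡⟨ solve 4 (λ c s k g → c :* s :- c :* k :* g := c :* (s :- k :* g)) refl c s k (g v) ⟩
    c * (s - k * g v)              ∎
    where
    open ≡-Reasoning
    c = 1/deg v
    s = ∑ (nbrs v) g
    k = fromℕ (length (nbrs v))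

  Lap-+* : ∀ f c g v → Lap (λ x → f x + c * g x) v ≡ Lap f v + c * Lap g v
  Lap-+* f c g v = trans
    (cong (_- k * (f v + c * g v)) (trans (∑-+ (nbrs v) f (λ x → c * g x))
      (cong (∑ (nbrs v) f +_) (∑-*ˡ (nbrs v) c g))))
    (solve 6 (λ a c b k f g → a :+ c :* b :- k :* (f :+ c :* g) := a :- k :* f :+ c :* (b :- k :* g)) refl
      (∑ (nbrs v) f) c (∑ (nbrs v) g) k (f v) (g v))
    where k = fromℕ (length (nbrs v))

  Lap-* : ∀ c g v → Lap (λ x → c * g x) v ≡ c * Lap g v
  Lap-* c g v = trans (cong (_- k * (c * g v)) (∑-*ˡ (nbrs v) c g))
    (solve 4 (λ c b k g → c :* b :- k :* (c :* g) := c :* (b :- k :* g)) refl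
      c (∑ (nbrs v) g) k (g v))
    where k = fromℕ (length (nbrs v))

  -- Distributions reachable with rational masses.

  Topplings-trans : ∀ {k l μ ν ξ} → Topplings k μ ν → Topplings l ν ξ → Topplings (k ℕ.+ l) μ ξ
  Topplings-trans [] s = s
  Topplings-trans {l = l} {ξ = ξ} (_∷_ {k} {v} {m} {μ} e t) s =
    _∷_ {k = k ℕ.+ l} {v = v} {m = m} {μ = μ} {ν = ξ} e (Topplings-trans t s)

  one-toppling : ∀ v m μ (p : 0ᴿ <ᴿ m) (q : m ≤ᴿ mass μ v) → Topplings 1 μ (topple v m μ p q)
  one-toppling v m μ p q = _∷_ {v = v} {m = m} {μ = μ} (p , q) []

  Represents : MassDistribution → (V → ℚ) → Set
  Represents μ f = ∀ x n → seq (mass μ x) n ≡ f x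

  gain-other : ∀ {v x} → v ≢ x → 0ℚ ℚ.≤ gain v x
  gain-other {v} {x} v≢x = subst (λ a → 0ℚ ℚ.≤ spread v x - a) (sym (δℚ-diff v≢x))
    (p≤q⇒0≤q-p (spread-nonneg v x))

  Φ-decreases : ∀ {S xs : List V} {m g c} → Unique S → (∀ {x} → x ∈ xs → x ∈ S) →
    (∀ x → 0ℚ ℚ.≤ m x) → (∀ x → 0ℚ ℚ.≤ g x) →
    (∀ {x} → x ∈ xs → Δ g x ℚ.≤ c * g x) → ∑ xs (λ x → m x * Φ S g (gain x)) ℚ.≤ c * Φ xs g m
  Φ-decreases {S} {xs} {m} {g} {c} u xs⊆S 0≤m 0≤g h = ℚ.≤-trans
    (∑-mono xs (λ {x} x∈ → subst (m x * Φ S g (gain x) ℚ.≤_)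
      (solve 3 (λ m c g → m :* (c :* g) := c :* (g :* m)) refl (m x) c (g x))
      (*-monoˡ-≤ (0≤m x) (ℚ.≤-trans (Φ-gain-≤ u (xs⊆S x∈) 0≤g) (h x∈)))))
    (ℚ.≤-reflexive (∑-*ˡ xs c (λ x → g x * m x)))

  module _ (ρ : V) where

    -- `K` bounds the number of moves and does not count it: a move needs positive mass, so toppling
    -- amount 0 is replaced by no move at all.
    Reachable : ℕ → (V → ℚ) → Set
    Reachable K f = ∃[ k ] ∃[ ν ] k ≤ K × Topplings k (δ ρ) ν × Represents ν f

    reachable-δ : Reachable 0 (δℚ ρ)
    reachable-δ = 0 , δ ρ , z≤n , [] , λ _ _ → refl

    -- Inherited from the distribution that represents `f`, so no sweep has to carry nonnegativity
    -- along.
    reachable-nonneg : ∀ {K f} → Reachable K f → ∀ x → 0ℚ ℚ.≤ f x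
    reachable-nonneg {f = f} (_ , ν , _ , _ , rep) x = ≤ᴿ⇒≤ {0ℚ} {f x}
      (≤ᴿ-trans {0ᴿ} {mass ν x} {fromℚ (f x)} (nonneg ν x)
        (≤ᴿ-pointwise {mass ν x} {fromℚ (f x)} (λ n → ℚ.≤-reflexive (rep x n))))

    reachable-topple : ∀ {K f m v} → 0ℚ ℚ.≤ m → m ℚ.≤ f v → Reachable K f →
      Reachable (suc K) (λ x → f x + m * gain v x)
    reachable-topple {K} {f} {m} {v} 0≤m m≤fv (k , ν , k≤K , t , rep) with 0ℚ ℚ.<? m
    ... | yes 0<m = k ℕ.+ 1 , topple v (fromℚ m) ν 0<ᴿm m≤ν , subst (_≤ suc K) (ℕ.+-comm 1 k) (s≤s k≤K) ,
      Topplings-trans t (one-toppling v (fromℚ m) ν 0<ᴿm m≤ν) ,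
      λ x n → trans (gain-seq v (fromℚ m) ν 0<ᴿm m≤ν x n) (cong (_+ m * gain v x) (rep x n))
      where
      0<ᴿm : 0ᴿ <ᴿ fromℚ m
      0<ᴿm = m , 0<m , 0 , λ _ _ → ℚ.≤-reflexive (ℚ.+-identityˡ m)
      m≤ν : fromℚ m ≤ᴿ mass ν v
      m≤ν = ≤ᴿ-pointwise {fromℚ m} {mass ν v} (λ n → subst (m ℚ.≤_) (sym (rep v n)) m≤fv)
    ... | no 0≮m = k , ν , ℕ.m≤n⇒m≤1+n k≤K , t , λ x n → trans (rep x n)
      (trans (solve 2 (λ f g → f := f :+ con 0ℚ :* g) refl (f x) (gain v x))
        (cong (λ a → f x + a * gain v x) (ℚ.≤-antisym 0≤m (ℚ.≮⇒≥ 0≮m))))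

    -- Toppling elsewhere only adds mass at a vertex still to come, so the amounts `m x` fixed in
    -- advance remain available. As they are fixed, the changes of every `Φ S g` simply add up.
    sweep : ∀ {K f} (m : V → ℚ) (xs : List V) → Unique xs →
      (∀ x → 0ℚ ℚ.≤ m x) → (∀ {x} → x ∈ xs → m x ℚ.≤ f x) → Reachable K f →
      ∃[ f′ ] Reachable (length xs ℕ.+ K) f′ ×
        (∀ S g → Φ S g f′ ≡ Φ S g f + ∑ xs (λ x → m x * Φ S g (gain x)))
    sweep {f = f} m [] _ _ _ r = f , r , λ S g → sym (ℚ.+-identityʳ (Φ S g f))
    sweep {K} {f} m (x ∷ xs) (x∉xs ∷ u) 0≤m m≤f r =
      let f′ , r′ , eq = sweep m xs u 0≤m
            (λ {y} y∈ → ℚ.≤-trans (m≤f (there y∈))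
              (p≤p+q (*-nonneg (0≤m x) (gain-other (All.lookup x∉xs y∈)))))
            (reachable-topple {K} {f} {m x} {x} (0≤m x) (m≤f (here refl)) r)
      in f′ , subst (λ k → Reachable k f′) (ℕ.+-suc (length xs) K) r′ , λ S g → trans (eq S g)
        (trans (cong (_+ ∑ xs (λ y → m y * Φ S g (gain y))) (Φ-move S g f (m x) (gain x)))
          (ℚ.+-assoc (Φ S g f) (m x * Φ S g (gain x)) _))

    reachable-mass : ∀ {A : Pred V 0ℓ} {p q K f} vs → Unique vs → All (λ v → ¬ A v) vs →
      p ≤ᴿ fromℚ q → q ℚ.≤ ∑ vs f → Reachable K f → ∃[ k ] k ≤ K × Transportable p A (δ ρ) k
    reachable-mass {A} {p} {q} {K} {f} vs u vs∌A p≤q q≤ (k , ν , k≤K , t , rep) =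
      k , k≤K , ν , t , λ r r<p → vs , u , vs∌A ,
        <ᴿ-≤ᴿ-trans {r} {p} {sumᴿ (map (mass ν) vs)} r<p
          (≤ᴿ-trans {p} {fromℚ q} {sumᴿ (map (mass ν) vs)} p≤q
            (≤ᴿ-pointwise {fromℚ q} {sumᴿ (map (mass ν) vs)} (λ n → subst (q ℚ.≤_)
              (trans (∑-cong vs (λ x → sym (rep x n))) (sym (seq-sumᴿ (mass ν) vs n))) q≤)))

-- The d-ary tree: degrees and Laplacian.

module Tree (d : ℕ) (2≤d : 2 ≤ d) where
  open Graph (𝕋 d) using (V; nbrs; _~_; _≟_)
  open Toppling (𝕋 d) using (δℚ; 1/deg; δ; Transportable)

  D : ℚ
  D = fromℕ d

  2≤D : fromℕ 2 ℚ.≤ D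
  2≤D = fromℕ-mono 2≤d

  0<D : 0ℚ ℚ.< D
  0<D = ℚ.<-≤-trans (ℚ.positive⁻¹ (fromℕ 2)) 2≤D

  private
    instance
      D>0 : ℚ.Positive D
      D>0 = ℚ.positive 0<D
      D≢0 : ℚ.NonZero D
      D≢0 = ℚ.pos⇒nonZero D

  ι : ℚ
  ι = ℚ.1/ D

  D*ι≡1 : D * ι ≡ 1ℚ
  D*ι≡1 = ℚ.*-inverseʳ D

  0<ι : 0ℚ ℚ.< ι
  0<ι = ℚ.positive⁻¹ ι {{ℚ.1/pos⇒pos D}}

  0≤ι : 0ℚ ℚ.≤ ι
  0≤ι = ℚ.<⇒≤ 0<ι

  0≤D : 0ℚ ℚ.≤ D
  0≤D = ℚ.<⇒≤ 0<D

  D^*ι^≡1 : ∀ n → D ^ℚ n * ι ^ℚ n ≡ 1ℚ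
  D^*ι^≡1 zero    = refl
  D^*ι^≡1 (suc n) = trans
    (solve 4 (λ D ι x y → D :* x :* (ι :* y) := D :* ι :* (x :* y)) refl D ι (D ^ℚ n) (ι ^ℚ n))
    (cong₂ _*_ D*ι≡1 (D^*ι^≡1 n))

  length-nbrs : ∀ v → length (nbrs v) ≡ d ℕ.+ length (parent v)
  length-nbrs v = trans (length-++ (map (_∷ v) (allFin d)))
    (cong (ℕ._+ length (parent v)) (trans (length-map (_∷ v) (allFin d)) (length-tabulate {n = d} _)))

  1≤deg : ∀ v → 1 ≤ length (nbrs v)
  1≤deg v = subst (1 ≤_) (sym (length-nbrs v))
    (ℕ.≤-trans (ℕ.≤-trans (ℕ.n≤1+n 1) 2≤d) (ℕ.m≤m+n d (length (parent v))))

  ∑-nbrs : ∀ v g → ∑ (nbrs v) g ≡ ∑ (allFin d) (λ i → g (i ∷ v)) + ∑ (parent v) g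
  ∑-nbrs v g = trans (∑-++ (map (_∷ v) (allFin d)) (parent v) g)
    (cong (_+ ∑ (parent v) g) (∑-map (_∷ v) (allFin d) g))

  Lap-𝕋 : ∀ g v → Lap (𝕋 d) g v ≡
    (∑ (allFin d) (λ i → g (i ∷ v)) + ∑ (parent v) g) - (D + fromℕ (length (parent v))) * g v
  Lap-𝕋 g v = cong₂ (λ a b → a - b * g v) (∑-nbrs v g)
    (trans (cong fromℕ (length-nbrs v)) (fromℕ-+ d (length (parent v))))

  ∑-allFin-const : ∀ c → ∑ (allFin d) (λ _ → c) ≡ D * c
  ∑-allFin-const c = trans (∑-const (allFin d) c)
    (cong (λ k → fromℕ k * c) (length-tabulate {n = d} _))

  -- A superharmonic function peaked at a given vertex.

  ∑-δ-child : ∀ i w v → ∑ (allFin d) (λ j → δℚ (i ∷ w) (j ∷ v)) ≡ δℚ w v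
  ∑-δ-child i w v = by-cases (w ≟ v)
    where
    open ≡-Reasoning
    ys = map (_∷ w) (allFin d)
    by-cases : Dec (w ≡ v) → ∑ (allFin d) (λ j → δℚ (i ∷ w) (j ∷ v)) ≡ δℚ w v
    by-cases (no w≢v) = begin
      ∑ (allFin d) (λ j → δℚ (i ∷ w) (j ∷ v))
        ≡⟨ ∑-cong (allFin d) (λ j → δℚ-diff (𝕋 d) {i ∷ w} {j ∷ v} (w≢v ∘ ∷-injectiveʳ)) ⟩
      ∑ (allFin d) (λ _ → 0ℚ)                        ≡⟨ ∑-zero (allFin d) ⟩
      0ℚ                                             ≡⟨ δℚ-diff (𝕋 d) w≢v ⟨
      δℚ w v                                         ∎
    by-cases (yes refl) = begin
      ∑ (allFin d) (λ j → δℚ (i ∷ w) (j ∷ w))        ≡⟨ ∑-map (_∷ w) (allFin d) _ ⟨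
      ∑ ys (δℚ (i ∷ w))                              ≡⟨ ∑-cong ys (λ x → sym (ℚ.*-identityˡ _)) ⟩
      Φ (𝕋 d) ys (λ _ → 1ℚ) (δℚ (i ∷ w))
        ≡⟨ Φ-δ-∈ (𝕋 d) (λ _ → 1ℚ) (Unique.map⁺ ∷-injectiveˡ (Unique.allFin⁺ d)) (∈-map⁺ (_∷ w) (∈-allFin i)) ⟩
      1ℚ                                             ≡⟨ δℚ-same (𝕋 d) w ⟨
      δℚ w w                                         ∎

  ∑-δ-root : ∀ v → ∑ (allFin d) (λ j → δℚ [] (j ∷ v)) ≡ 0ℚ
  ∑-δ-root v = trans (∑-cong (allFin d) (λ j → δℚ-diff (𝕋 d) {[]} {j ∷ v} (λ ()))) (∑-zero (allFin d))

  -- The indicator of the subtree below u: the number of suffixes of x equal to u.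
  sub : V → V → ℚ
  sub u []      = δℚ u []
  sub u (i ∷ x) = δℚ u (i ∷ x) + sub u x

  sub-nonneg : ∀ u x → 0ℚ ℚ.≤ sub u x
  sub-nonneg u []      = δℚ-nonneg (𝕋 d) u []
  sub-nonneg u (i ∷ x) = ℚ.+-mono-≤ (δℚ-nonneg (𝕋 d) u (i ∷ x)) (sub-nonneg u x)

  φ : V → V → ℚ
  φ u x = ι ^ℚ length x * sub u x

  -- The degree less one: at `u` the children together give back `D * ι = 1` in units of `ι^|u|`.
  inner-degree : V → ℚ
  inner-degree []      = D - 1ℚ
  inner-degree (_ ∷ _) = D

  -- The function `ι^|x|` is harmonic off the root, so cutting it down to the subtree below `u`
  -- leaves a Laplacian only at `u` and at the parent of `u`.
  Lap-φ : ∀ u v → Lap (𝕋 d) (φ u) v ≡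
    ι ^ℚ suc (length v) * ∑ (allFin d) (λ j → δℚ u (j ∷ v)) - inner-degree v * (ι ^ℚ length v * δℚ u v)
  Lap-φ u v = trans (Lap-𝕋 (φ u) v) (trans
    (cong (λ a → (a + ∑ (parent v) (φ u)) - (D + fromℕ (length (parent v))) * φ u v) kids) (main v))
    where
    open ≡-Reasoning
    S : V → ℚ
    S v = ∑ (allFin d) (λ j → δℚ u (j ∷ v))
    kids : ∑ (allFin d) (λ j → φ u (j ∷ v)) ≡ ι ^ℚ suc (length v) * (S v + D * sub u v)
    kids = trans (∑-*ˡ (allFin d) (ι ^ℚ suc (length v)) (λ j → sub u (j ∷ v)))
      (cong (ι ^ℚ suc (length v) *_) (trans (∑-+ (allFin d) (λ j → δℚ u (j ∷ v)) (λ _ → sub u v))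
        (cong (S v +_) (∑-allFin-const (sub u v)))))
    -- The ring solver cannot use `D * ι = 1`; both identities below are solved up to a multiple of
    -- `D * ι - 1`, which is discarded here.
    vanish : ∀ {x} a b → x ≡ 1ℚ → a + (x - 1ℚ) * b ≡ a
    vanish a b refl = solve 2 (λ a b → a :+ (con 1ℚ :- con 1ℚ) :* b := a) refl a b
    main : ∀ v → (ι ^ℚ suc (length v) * (S v + D * sub u v) + ∑ (parent v) (φ u))
      - (D + fromℕ (length (parent v))) * φ u v ≡
      ι ^ℚ suc (length v) * S v - inner-degree v * (ι ^ℚ length v * δℚ u v)
    main [] = trans
      (solve 4 (λ D ι s e → (ι :* con 1ℚ :* (s :+ D :* e) :+ con 0ℚ) :- (D :+ con 0ℚ) :* (con 1ℚ :* e) :=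
          ι :* con 1ℚ :* s :- (D :- con 1ℚ) :* (con 1ℚ :* e) :+ (D :* ι :- con 1ℚ) :* e)
        refl D ι (S []) (δℚ u []))
      (vanish _ (δℚ u []) D*ι≡1)
    main (k ∷ v) = trans
      (solve 6 (λ D ι P s e t →
          (ι :* (ι :* P) :* (s :+ D :* (e :+ t)) :+ (P :* t :+ con 0ℚ)) :- (D :+ con 1ℚ) :* (ι :* P :* (e :+ t)) :=
          ι :* (ι :* P) :* s :- D :* (ι :* P :* e) :+ (D :* ι :- con 1ℚ) :* (ι :* P :* (e :+ t) :- P :* t))
        refl D ι (ι ^ℚ length v) (S (k ∷ v)) (δℚ u (k ∷ v)) (sub u v))
      (vanish _ (ι ^ℚ suc (length v) * sub u (k ∷ v) - ι ^ℚ length v * sub u v) D*ι≡1)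

  -- If the paths from the root to `x` and `w` share m edges, then ι^dist(x,w) = ι^(|x|+|w|) D^(2m).
  -- The increment D^(2L+2) - D^(2L) is `jump L`, so `H` builds D^(2m) + 1 as a telescoping sum
  -- starting from 2.
  jump : ℕ → ℚ
  jump L = D ^ℚ L * D ^ℚ L * (D * D - 1ℚ)

  -- Multiplied by ι^|w|, H w x is ι^dist(x,w) + ι^(|w|+|x|). The first term
  -- is superharmonic except at the root, which the second one repairs.
  H : V → V → ℚ
  H []      x = fromℕ 2 * φ [] x
  H (i ∷ w) x = H w x + jump (length w) * φ (i ∷ w) x

  δℚ-weight : ∀ (F : V → ℚ) w v → F v * δℚ w v ≡ F w * δℚ w v
  δℚ-weight F w v with w ≟ v
  ... | yes refl = refl
  ... | no _     = trans (ℚ.*-zeroʳ (F v)) (sym (ℚ.*-zeroʳ (F w)))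

  -- The term of `i ∷ w` in `H` has Laplacian `slope (length w)` at `w`, and `-D` times this at
  -- `i ∷ w`, which is minus the `slope` of the next length.
  slope : ℕ → ℚ
  slope L = D ^ℚ L * (D - ι)

  jump-slope : ∀ L → jump L * (ι * ι ^ℚ L) ≡ slope L
  jump-slope L = trans
    (solve 4 (λ D ι x y → x :* x :* (D :* D :- con 1ℚ) :* (ι :* y) :=
      x :* (x :* y) :* (D :* (D :* ι) :- ι)) refl D ι (D ^ℚ L) (ι ^ℚ L))
    (trans (cong₂ (λ a b → D ^ℚ L * a * (D * b - ι)) (D^*ι^≡1 L) D*ι≡1)
      (solve 3 (λ D ι x → x :* con 1ℚ :* (D :* con 1ℚ :- ι) := x :* (D :- ι)) refl D ι (D ^ℚ L)))

  -- jump is chosen so that in Lap (H (i ∷ w)) the contributions at w cancel.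
  Lap-H : ∀ w v → Lap (𝕋 d) (H w) v ℚ.≤ - (slope (length w) * δℚ w v)
  Lap-H [] v = begin
    Lap (𝕋 d) (H []) v
      ≡⟨ Lap-* (𝕋 d) (fromℕ 2) (φ []) v ⟩
    fromℕ 2 * Lap (𝕋 d) (φ []) v
      ≡⟨ cong (fromℕ 2 *_) (Lap-φ [] v) ⟩
    fromℕ 2 * (ι ^ℚ suc (length v) * ∑ (allFin d) (λ j → δℚ [] (j ∷ v)) - inner-degree v * (ι ^ℚ length v * δℚ [] v))
      ≡⟨ cong₂ (λ a b → fromℕ 2 * (ι ^ℚ suc (length v) * a - b)) (∑-δ-root v)
           (trans (sym (ℚ.*-assoc (inner-degree v) (ι ^ℚ length v) (δℚ [] v)))
             (δℚ-weight (λ v → inner-degree v * ι ^ℚ length v) [] v)) ⟩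
    fromℕ 2 * (ι ^ℚ suc (length v) * 0ℚ - (D - 1ℚ) * 1ℚ * δℚ [] v)
      ≡⟨ solve 3 (λ x D e → con (fromℕ 2) :* (x :* con 0ℚ :- (D :- con 1ℚ) :* con 1ℚ :* e) :=
           :- (con (fromℕ 2) :* (D :- con 1ℚ) :* e)) refl (ι ^ℚ suc (length v)) D (δℚ [] v) ⟩
    - (fromℕ 2 * (D - 1ℚ) * δℚ [] v)
      ≤⟨ ℚ.neg-antimono-≤ (*-monoʳ-≤ (δℚ-nonneg (𝕋 d) [] v) slope≤) ⟩
    - (slope 0 * δℚ [] v) ∎
    where
    open ℚ.≤-Reasoning
    -- The Laplacian of `H []` at the root is `-2 (D - 1)`, and `2 ≤ D` makes this at most
    -- `-slope 0`.
    slope≤ : slope 0 ℚ.≤ fromℕ 2 * (D - 1ℚ)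
    slope≤ = 0≤q-p⇒p≤q (subst (0ℚ ℚ.≤_)
      (solve 2 (λ D ι → (D :- con (fromℕ 2)) :+ ι := con (fromℕ 2) :* (D :- con 1ℚ) :- con 1ℚ :* (D :- ι)) refl D ι)
      (ℚ.+-mono-≤ (p≤q⇒0≤q-p 2≤D) 0≤ι))
  Lap-H (i ∷ w) v = begin
    Lap (𝕋 d) (H (i ∷ w)) v
      ≡⟨ Lap-+* (𝕋 d) (H w) (jump L) (φ (i ∷ w)) v ⟩
    Lap (𝕋 d) (H w) v + jump L * Lap (𝕋 d) (φ (i ∷ w)) v
      ≤⟨ ℚ.+-mono-≤ (Lap-H w v) (ℚ.≤-reflexive step) ⟩
    - (slope L * δℚ w v) + (slope L * δℚ w v - slope (suc L) * δℚ (i ∷ w) v)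
      ≡⟨ solve 2 (λ a b → :- a :+ (a :- b) := :- b) refl (slope L * δℚ w v) (slope (suc L) * δℚ (i ∷ w) v) ⟩
    - (slope (suc L) * δℚ (i ∷ w) v) ∎
    where
    open ℚ.≤-Reasoning
    L = length w
    step : jump L * Lap (𝕋 d) (φ (i ∷ w)) v ≡ slope L * δℚ w v - slope (suc L) * δℚ (i ∷ w) v
    step = begin-equality
      jump L * Lap (𝕋 d) (φ (i ∷ w)) v
        ≡⟨ cong (jump L *_) (trans (Lap-φ (i ∷ w) v) (cong₂ (λ a b → ι ^ℚ suc (length v) * a - b)
             (∑-δ-child i w v)
             (trans (sym (ℚ.*-assoc (inner-degree v) (ι ^ℚ length v) (δℚ (i ∷ w) v)))
               (δℚ-weight (λ v → inner-degree v * ι ^ℚ length v) (i ∷ w) v)))) ⟩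
      jump L * (ι ^ℚ suc (length v) * δℚ w v - D * (ι * ι ^ℚ L) * δℚ (i ∷ w) v)
        ≡⟨ cong (λ a → jump L * (a - D * (ι * ι ^ℚ L) * δℚ (i ∷ w) v)) (δℚ-weight (λ v → ι ^ℚ suc (length v)) w v) ⟩
      jump L * (ι * ι ^ℚ L * δℚ w v - D * (ι * ι ^ℚ L) * δℚ (i ∷ w) v)
        ≡⟨ solve 5 (λ j x D a b → j :* (x :* a :- D :* x :* b) := j :* x :* a :- D :* (j :* x) :* b) refl
             (jump L) (ι * ι ^ℚ L) D (δℚ w v) (δℚ (i ∷ w) v) ⟩
      jump L * (ι * ι ^ℚ L) * δℚ w v - D * (jump L * (ι * ι ^ℚ L)) * δℚ (i ∷ w) v
        ≡⟨ cong (λ s → s * δℚ w v - D * s * δℚ (i ∷ w) v) (jump-slope L) ⟩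
      slope L * δℚ w v - D * slope L * δℚ (i ∷ w) v
        ≡⟨ cong (λ s → slope L * δℚ w v - s * δℚ (i ∷ w) v) (sym (ℚ.*-assoc D (D ^ℚ L) (D - ι))) ⟩
      slope L * δℚ w v - slope (suc L) * δℚ (i ∷ w) v ∎

  1≤D : 1ℚ ℚ.≤ D
  1≤D = ℚ.≤-trans (fromℕ-mono (ℕ.n≤1+n 1)) 2≤D

  ι≤1 : ι ℚ.≤ 1ℚ
  ι≤1 = subst₂ ℚ._≤_ (ℚ.*-identityˡ ι) D*ι≡1 (*-monoʳ-≤ 0≤ι 1≤D)

  slope-nonneg : ∀ L → 0ℚ ℚ.≤ slope L
  slope-nonneg L = *-nonneg (^ℚ-nonneg 0≤D L) (p≤q⇒0≤q-p (ℚ.≤-trans ι≤1 1≤D))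

  jump-nonneg : ∀ L → 0ℚ ℚ.≤ jump L
  jump-nonneg L = *-nonneg (*-nonneg (^ℚ-nonneg 0≤D L) (^ℚ-nonneg 0≤D L))
    (p≤q⇒0≤q-p (ℚ.≤-trans 1≤D (subst (ℚ._≤ D * D) (ℚ.*-identityʳ D) (*-monoˡ-≤ 0≤D 1≤D))))

  φ-nonneg : ∀ u x → 0ℚ ℚ.≤ φ u x
  φ-nonneg u x = *-nonneg (^ℚ-nonneg 0≤ι (length x)) (sub-nonneg u x)

  H-nonneg : ∀ w x → 0ℚ ℚ.≤ H w x
  H-nonneg []      x = *-nonneg (fromℕ-nonneg 2) (φ-nonneg [] x)
  H-nonneg (i ∷ w) x = ℚ.+-mono-≤ (H-nonneg w x) (*-nonneg (jump-nonneg (length w)) (φ-nonneg (i ∷ w) x))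

  H-root : ∀ w → H w [] ≡ fromℕ 2
  H-root []      = cong (λ s → fromℕ 2 * (1ℚ * s)) (δℚ-same (𝕋 d) [])
  H-root (i ∷ w) = trans (cong₂ (λ a b → a + jump (length w) * (1ℚ * b)) (H-root w) (δℚ-diff (𝕋 d) {i ∷ w} {[]} (λ ())))
    (solve 1 (λ j → con (fromℕ 2) :+ j :* (con 1ℚ :* con 0ℚ) := con (fromℕ 2)) refl (jump (length w)))

  φ-child : ∀ u i x → ι * φ u x ℚ.≤ φ u (i ∷ x)
  φ-child u i x = subst (ℚ._≤ φ u (i ∷ x)) (ℚ.*-assoc ι (ι ^ℚ length x) (sub u x))
    (*-monoˡ-≤ (^ℚ-nonneg 0≤ι (suc (length x)))
      (subst (sub u x ℚ.≤_) (ℚ.+-comm (sub u x) (δℚ u (i ∷ x))) (p≤p+q (δℚ-nonneg (𝕋 d) u (i ∷ x)))))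

  H-child : ∀ w i x → ι * H w x ℚ.≤ H w (i ∷ x)
  H-child [] i x = subst (ℚ._≤ H [] (i ∷ x))
    (solve 2 (λ ι p → con (fromℕ 2) :* (ι :* p) := ι :* (con (fromℕ 2) :* p)) refl ι (φ [] x))
    (*-monoˡ-≤ (fromℕ-nonneg 2) (φ-child [] i x))
  H-child (k ∷ w) i x = subst (ℚ._≤ H (k ∷ w) (i ∷ x))
    (solve 4 (λ ι h j p → ι :* h :+ j :* (ι :* p) := ι :* (h :+ j :* p)) refl ι (H w x) (jump (length w)) (φ (k ∷ w) x))
    (ℚ.+-mono-≤ (H-child w i x) (*-monoˡ-≤ (jump-nonneg (length w)) (φ-child (k ∷ w) i x)))

  1≤sub : ∀ u → 1ℚ ℚ.≤ sub u u
  1≤sub []      = ℚ.≤-reflexive (sym (δℚ-same (𝕋 d) []))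
  1≤sub (i ∷ u) = subst (λ a → 1ℚ ℚ.≤ a + sub (i ∷ u) u) (sym (δℚ-same (𝕋 d) (i ∷ u)))
    (p≤p+q (sub-nonneg (i ∷ u) u))

  ι^≤φ : ∀ u → ι ^ℚ length u ℚ.≤ φ u u
  ι^≤φ u = subst (ℚ._≤ φ u u) (ℚ.*-identityʳ (ι ^ℚ length u))
    (*-monoˡ-≤ (^ℚ-nonneg 0≤ι (length u)) (1≤sub u))

  -- One step away from the root costs `H w` at most a factor `ι`, by `H-child`, and the new term
  -- contributes at least `slope L`, exactly what lifts `ι * D^L` to `D^(L+1)`.
  D^≤H : ∀ w → D ^ℚ length w ℚ.≤ H w w
  D^≤H []      = ℚ.≤-trans (fromℕ-mono (ℕ.n≤1+n 1)) (ℚ.≤-reflexive (sym (H-root [])))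
  D^≤H (i ∷ w) = begin
    D * D ^ℚ L
      ≡⟨ solve 3 (λ D ι x → D :* x := ι :* x :+ x :* (D :- ι)) refl D ι (D ^ℚ L) ⟩
    ι * D ^ℚ L + slope L
      ≡⟨ cong (ι * D ^ℚ L +_) (jump-slope L) ⟨
    ι * D ^ℚ L + jump L * (ι * ι ^ℚ L)
      ≤⟨ ℚ.+-mono-≤ (ℚ.≤-trans (*-monoˡ-≤ 0≤ι (D^≤H w)) (H-child w i w))
           (*-monoˡ-≤ (jump-nonneg L) (ι^≤φ (i ∷ w))) ⟩
    H (i ∷ w) (i ∷ w) ∎
    where
    open ℚ.≤-Reasoning
    L = length w

  green : V → V → ℚ
  green w x = ι ^ℚ length w * H w x

  green-superharmonic : ∀ w → Superharmonic (𝕋 d) (green w)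
  green-superharmonic w = (λ x → *-nonneg (^ℚ-nonneg 0≤ι (length w)) (H-nonneg w x)) , λ v → begin
    Δ (𝕋 d) (green w) v
      ≡⟨ Δ-Lap (𝕋 d) (green w) (1≤deg v) ⟩
    1/deg v * Lap (𝕋 d) (green w) v
      ≡⟨ cong (1/deg v *_) (Lap-* (𝕋 d) (ι ^ℚ length w) (H w) v) ⟩
    1/deg v * (ι ^ℚ length w * Lap (𝕋 d) (H w) v)
      ≤⟨ *-monoˡ-≤ (1/deg-nonneg (𝕋 d) v) (*-monoˡ-≤ (^ℚ-nonneg 0≤ι (length w)) (ℚ.≤-trans (Lap-H w v)
           (ℚ.neg-antimono-≤ (*-nonneg (slope-nonneg (length w)) (δℚ-nonneg (𝕋 d) w v))))) ⟩
    1/deg v * (ι ^ℚ length w * 0ℚ)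
      ≡⟨ solve 2 (λ a b → a :* (b :* con 0ℚ) := con 0ℚ) refl (1/deg v) (ι ^ℚ length w) ⟩
    0ℚ ∎
    where open ℚ.≤-Reasoning

  1≤green : ∀ w → 1ℚ ℚ.≤ green w w
  1≤green w = subst (ℚ._≤ green w w) (trans (ℚ.*-comm (ι ^ℚ length w) (D ^ℚ length w)) (D^*ι^≡1 (length w)))
    (*-monoˡ-≤ (^ℚ-nonneg 0≤ι (length w)) (D^≤H w))

  -- The lower bound on the tree.

  far : ℕ → V → ℚ
  far n x with n ℕ.≤? length x
  ... | yes _ = 1ℚ
  ... | no _  = 0ℚ

  far-≥ : ∀ {n x} → n ≤ length x → far n x ≡ 1ℚ
  far-≥ {n} {x} h with n ℕ.≤? length x
  ... | yes _ = refl
  ... | no ¬h = ⊥-elim (¬h h)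

  far-< : ∀ {n x} → length x ℕ.< n → far n x ≡ 0ℚ
  far-< {n} {x} h with n ℕ.≤? length x
  ... | yes h′ = ⊥-elim (ℕ.<⇒≱ h h′)
  ... | no _   = refl

  far-nonneg : ∀ n x → 0ℚ ℚ.≤ far n x
  far-nonneg n x with n ℕ.≤? length x
  ... | yes _ = 0≤1
  ... | no _  = ℚ.≤-refl

  far≤1 : ∀ n x → far n x ℚ.≤ 1ℚ
  far≤1 n x with n ℕ.≤? length x
  ... | yes _ = ℚ.≤-refl
  ... | no _  = 0≤1

  ~⇒length≤ : ∀ {v y : V} → v ~ y → length y ≤ suc (length v)
  ~⇒length≤ (inj₁ (_ , refl)) = ℕ.≤-refl
  ~⇒length≤ (inj₂ (_ , refl)) = ℕ.m≤n⇒m≤1+n (ℕ.n≤1+n _)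

  walk⇒length≤ : ∀ {k} {u v : V} → Walk _~_ k u v → length u ≤ k ℕ.+ length v
  walk⇒length≤ []      = ℕ.≤-refl
  walk⇒length≤ (e ∷ w) = ℕ.≤-trans (~⇒length≤ (Graph.~-sym (𝕋 d) e)) (s≤s (walk⇒length≤ w))

  walk-to-root : ∀ (v : V) → Walk _~_ (length v) v root
  walk-to-root []      = []
  walk-to-root (i ∷ v) = inj₂ (i , refl) ∷ walk-to-root v

  -- For shorter words no neighbour is far, and for longer words `far` already has its maximum at
  -- `v`. Only words of length `L` need the mass bound, which `green v` supplies.
  far-control : ∀ L v → Δ (𝕋 d) (far (suc L)) v ℚ.≤ 0ℚ ⊎
    Δ (𝕋 d) (far (suc L)) v ℚ.≤ 1ℚ ×
      ∃[ g ] Superharmonic (𝕋 d) g × 1ℚ ℚ.≤ g v × g root ℚ.≤ ι ^ℚ L * fromℕ 2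
  far-control L v with ℕ.<-cmp (length v) L
  ... | tri< |v|<L _ _ = inj₁ (subst (Δ (𝕋 d) (far (suc L)) v ℚ.≤_)
    (cong (λ a → 0ℚ - a) (far-< {suc L} {v} (ℕ.m<n⇒m<1+n |v|<L)))
    (Δ-≤ (𝕋 d) (1≤deg v) (λ {y} y∈ → ℚ.≤-reflexive (far-< {suc L} {y}
      (s≤s (ℕ.≤-trans (~⇒length≤ {v} {y} (Equivalence.to (Graph.∈-nbrs (𝕋 d)) y∈)) |v|<L))))))
  ... | tri> _ _ L<|v| = inj₁ (subst (Δ (𝕋 d) (far (suc L)) v ℚ.≤_)
    (cong (λ a → 1ℚ - a) (far-≥ {suc L} {v} L<|v|))
    (Δ-≤ (𝕋 d) (1≤deg v) (λ {y} _ → far≤1 (suc L) y)))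
  ... | tri≈ _ refl _ = inj₂
    ( subst (Δ (𝕋 d) (far (suc L)) v ℚ.≤_) (cong (λ a → 1ℚ - a) (far-< {suc L} {v} ℕ.≤-refl))
        (Δ-≤ (𝕋 d) (1≤deg v) (λ {y} _ → far≤1 (suc L) y))
    , green v , green-superharmonic v , 1≤green v
    , ℚ.≤-reflexive (cong (ι ^ℚ L *_) (H-root v)) )

  module _ (em : ExcludedMiddle 0ℓ) where

    ∉-Ball⁻ : ∀ {n} v → ¬ Ball em (𝕋 d) root n v → n ≤ length v
    ∉-Ball⁻ {n} v v∉B = ℕ.≮⇒≥ (λ |v|<n →
      let j , eq , _ , j≤ = minimum-≤ em (λ k → Walk _~_ k v root) (length v) (walk-to-root v)
      in v∉B (subst (_<∞ [ n ]) (sym eq) Strict.[ ℕ.≤-<-trans j≤ |v|<n ]))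

    ∉-Ball⁺ : ∀ {n} v → n ≤ length v → ¬ Ball em (𝕋 d) root n v
    ∉-Ball⁺ {n} v n≤|v| v∈B =
      let j , walk , j<n = minimum-<∞ em (λ k → Walk _~_ k v root) n v∈B
      in ℕ.<⇒≱ j<n (ℕ.≤-trans n≤|v| (subst (length v ≤_) (ℕ.+-identityʳ j) (walk⇒length≤ walk)))

    -- The factor `½ * ι` turns the gain `2 ι^n` of one move into `ι^(n+1)`, the inverse of
    -- `D^(n+1)`.
    lower-bound : ∀ {p q k} n → fromℚ q <ᴿ p → Transportable p (Ball em (𝕋 d) root (suc n)) (δ root) k →
      D ^ℚ suc n * (q * (½ * ι)) ℚ.≤ fromℕ k
    lower-bound {p} {q} {k} n q<p t = begin
      D ^ℚ suc n * (q * (½ * ι))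
        ≤⟨ *-monoˡ-≤ (^ℚ-nonneg 0≤D (suc n)) (*-monoʳ-≤ (*-nonneg (ℚ.nonNegative⁻¹ ½) 0≤ι)
             (transport-cost (𝕋 d) {root} {far (suc n)} {ι ^ℚ n * fromℕ 2} (far-nonneg (suc n))
               (*-nonneg (^ℚ-nonneg 0≤ι n) (fromℕ-nonneg 2)) (far-control n)
               {Ball em (𝕋 d) root (suc n)} {p} {q} {k}
               (λ v v∉B → ℚ.≤-reflexive (sym (far-≥ {suc n} {v} (∉-Ball⁻ v v∉B))))
               ℚ.≤-refl q<p t)) ⟩
      D ^ℚ suc n * (fromℕ k * (ι ^ℚ n * fromℕ 2) * (½ * ι))
        ≡⟨ solve 4 (λ x k y ι → x :* (k :* (y :* con (fromℕ 2)) :* (con ½ :* ι)) := x :* (ι :* y) :* k) refl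
             (D ^ℚ suc n) (fromℕ k) (ι ^ℚ n) ι ⟩
      D ^ℚ suc n * ι ^ℚ suc n * fromℕ k
        ≡⟨ cong (_* fromℕ k) (D^*ι^≡1 (suc n)) ⟩
      1ℚ * fromℕ k
        ≡⟨ ℚ.*-identityˡ (fromℕ k) ⟩
      fromℕ k ∎
      where open ℚ.≤-Reasoning

  -- Sizes of levels and balls.

  level : ℕ → List V
  level zero    = [] ∷ []
  level (suc n) = cartesianProductWith _∷_ (allFin d) (level n)

  ball : ℕ → List V
  ball zero    = []
  ball (suc n) = level n ++ ball n

  ∈-level⁺ : ∀ x → x ∈ level (length x)
  ∈-level⁺ []      = here refl
  ∈-level⁺ (i ∷ x) = ∈-cartesianProductWith⁺ _∷_ (∈-allFin i) (∈-level⁺ x)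

  ∈-level⁻ : ∀ {n x} → x ∈ level n → length x ≡ n
  ∈-level⁻ {zero}  (here refl) = refl
  ∈-level⁻ {suc n} x∈ with _ , _ , _ , y∈ , refl ← ∈-cartesianProductWith⁻ _∷_ (allFin d) (level n) x∈ =
    cong suc (∈-level⁻ y∈)

  ∈-ball⁺ : ∀ {n} x → length x ℕ.< n → x ∈ ball n
  ∈-ball⁺ {suc n} x |x|<1+n with ℕ.m≤n⇒m<n∨m≡n (ℕ.≤-pred |x|<1+n)
  ... | inj₁ |x|<n = ∈-++⁺ʳ (level n) (∈-ball⁺ x |x|<n)
  ... | inj₂ refl  = ∈-++⁺ˡ (∈-level⁺ x)

  ∈-ball⁻ : ∀ {n x} → x ∈ ball n → length x ℕ.< n
  ∈-ball⁻ {suc n} x∈ with ∈-++⁻ (level n) x∈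
  ... | inj₁ x∈level = s≤s (ℕ.≤-reflexive (∈-level⁻ x∈level))
  ... | inj₂ x∈ball  = ℕ.m<n⇒m<1+n (∈-ball⁻ x∈ball)

  level-unique : ∀ n → Unique (level n)
  level-unique zero    = [] ∷ []
  level-unique (suc n) = Unique.cartesianProductWith⁺ _∷_ ∷-injective (Unique.allFin⁺ d) (level-unique n)

  ball-unique : ∀ n → Unique (ball n)
  ball-unique zero    = []
  ball-unique (suc n) = Unique.++⁺ (level-unique n) (ball-unique n)
    (λ (x∈level , x∈ball) → ℕ.<-irrefl (∈-level⁻ {n} x∈level) (∈-ball⁻ {n} x∈ball))

  length-level : ∀ n → length (level n) ≡ d ^ n
  length-level zero    = refl
  length-level (suc n) = trans (length-product (allFin d))
    (cong₂ ℕ._*_ (length-tabulate {n = d} _) (length-level n))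
    where
    length-product : ∀ (is : List (Fin d)) →
      length (cartesianProductWith {C = V} _∷_ is (level n)) ≡ length is ℕ.* length (level n)
    length-product []       = refl
    length-product (i ∷ is) = trans (length-++ (map (i ∷_) (level n)))
      (cong₂ ℕ._+_ (length-map (i ∷_) (level n)) (length-product is))

  2*d^n≤d^1+n : ∀ n → 2 ℕ.* d ^ n ≤ d ^ suc n
  2*d^n≤d^1+n n = ℕ.*-monoˡ-≤ (d ^ n) 2≤d

  length-ball : ∀ n → length (ball n) ≤ d ^ n
  length-ball zero    = z≤n
  length-ball (suc n) = begin
    length (level n ++ ball n)              ≡⟨ length-++ (level n) ⟩
    length (level n) ℕ.+ length (ball n)    ≤⟨ ℕ.+-mono-≤ (ℕ.≤-reflexive (length-level n)) (length-ball n) ⟩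
    d ^ n ℕ.+ d ^ n                         ≡⟨ cong (d ^ n ℕ.+_) (ℕ.+-identityʳ (d ^ n)) ⟨
    2 ℕ.* d ^ n                             ≤⟨ 2*d^n≤d^1+n n ⟩
    d ^ suc n                               ∎
    where open ℕ.≤-Reasoning

  total : ℕ → ℕ
  total zero    = 0
  total (suc n) = length (ball (suc n)) ℕ.+ total n

  -- A geometric series of ratio at least 2: the earlier balls together stay within
  -- `2 d^n ≤ d^(n+1)`, the bound for the last one.
  total-≤ : ∀ n → total n ≤ 2 ℕ.* d ^ n
  total-≤ zero    = z≤n
  total-≤ (suc n) = begin
    length (ball (suc n)) ℕ.+ total n     ≤⟨ ℕ.+-mono-≤ (length-ball (suc n)) (ℕ.≤-trans (total-≤ n) (2*d^n≤d^1+n n)) ⟩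
    d ^ suc n ℕ.+ d ^ suc n               ≡⟨ cong (d ^ suc n ℕ.+_) (ℕ.+-identityʳ (d ^ suc n)) ⟨
    2 ℕ.* d ^ suc n                       ∎
    where open ℕ.≤-Reasoning

  -- Outward drift in the weighted mass.

  -- The quantity (2/3)/Λ + Λ/3 is below 1 exactly for 1 < Λ < 2; the value 3/2 is rational and
  -- close to the minimiser √2.
  Λ κ θ : ℚ
  Λ = pos 3 ℚ./ 2
  κ = - (pos 1 ℚ./ 18)
  θ = pos 17 ℚ./ 18

  1≤Λ^ : ∀ k → 1ℚ ℚ.≤ Λ ^ℚ k
  1≤Λ^ zero    = ℚ.≤-refl
  1≤Λ^ (suc k) = ℚ.≤-trans (1≤Λ^ k) (subst (ℚ._≤ Λ * Λ ^ℚ k) (ℚ.*-identityˡ (Λ ^ℚ k))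
    (*-monoʳ-≤ (ℚ.≤-trans 0≤1 (1≤Λ^ k)) (p≤p+q {1ℚ} {½} (ℚ.nonNegative⁻¹ ½))))

  ψ : ℕ → V → ℚ
  ψ j x = Λ ^ℚ (j ∸ length x)

  1≤ψ : ∀ j x → 1ℚ ℚ.≤ ψ j x
  1≤ψ j x = 1≤Λ^ (j ∸ length x)

  ψ-nonneg : ∀ j x → 0ℚ ℚ.≤ ψ j x
  ψ-nonneg j x = ℚ.≤-trans 0≤1 (1≤ψ j x)

  ∑-children-ψ : ∀ j v → ∑ (allFin d) (λ i → ψ j (i ∷ v)) ≡ D * Λ ^ℚ (j ∸ suc (length v))
  ∑-children-ψ j v = ∑-allFin-const (Λ ^ℚ (j ∸ suc (length v)))

  -- The walk moves away from the root with probability at least 2/3, and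
  -- (2/3) Λ⁻¹ + (1/3) Λ = θ = 1 + κ; Λ = 3/2 makes this less than 1.
  Lap-ψ : ∀ {j} v → length v ℕ.< j →
    Lap (𝕋 d) (ψ j) v ℚ.≤ fromℕ (length (nbrs v)) * (κ * ψ j v)
  Lap-ψ {j} v |v|<j = subst₂ ℚ._≤_
    (sym (trans (Lap-𝕋 (ψ j) v) (cong (λ a → (a + ∑ (parent v) (ψ j)) - (D + fromℕ (length (parent v))) * ψ j v)
      (∑-children-ψ j v))))
    (cong (_* (κ * ψ j v)) (sym (trans (cong fromℕ (length-nbrs v)) (fromℕ-+ d (length (parent v))))))
    (0≤q-p⇒p≤q (bound j v |v|<j))
    where
    bound : ∀ j v → length v ℕ.< j → 0ℚ ℚ.≤ (D + fromℕ (length (parent v))) * (κ * ψ j v) -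
      ((D * Λ ^ℚ (j ∸ suc (length v)) + ∑ (parent v) (ψ j)) - (D + fromℕ (length (parent v))) * ψ j v)
    -- Here 5/12 is `θ * Λ - 1`.
    bound (suc j) [] _ = subst (0ℚ ℚ.≤_)
      (solve 2 (λ D P → con (pos 5 ℚ./ 12) :* D :* P :=
        (D :+ con 0ℚ) :* (con κ :* (con Λ :* P)) :- ((D :* P :+ con 0ℚ) :- (D :+ con 0ℚ) :* (con Λ :* P)))
        refl D (Λ ^ℚ j))
      (*-nonneg (*-nonneg (ℚ.nonNegative⁻¹ (pos 5 ℚ./ 12)) 0≤D) (ℚ.≤-trans 0≤1 (1≤Λ^ j)))
    -- The slack is proportional to `D - 2`: away from the root the binary tree attains equality.
    bound (suc j) (i ∷ v) (s≤s |v|<j)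
      rewrite ∸-suc (ℕ.m<n⇒m<1+n |v|<j) | ∸-suc |v|<j = subst (0ℚ ℚ.≤_)
      (solve 2 (λ D P → con (pos 5 ℚ./ 12) :* (D :- con (fromℕ 2)) :* P :=
        (D :+ con 1ℚ) :* (con κ :* (con Λ :* P)) :-
          ((D :* P :+ (con Λ :* (con Λ :* P) :+ con 0ℚ)) :- (D :+ con 1ℚ) :* (con Λ :* P)))
        refl D (Λ ^ℚ (j ∸ suc (length v))))
      (*-nonneg (*-nonneg (ℚ.nonNegative⁻¹ (pos 5 ℚ./ 12)) (p≤q⇒0≤q-p 2≤D))
        (ℚ.≤-trans 0≤1 (1≤Λ^ (j ∸ suc (length v)))))

  Δ-ψ : ∀ {j} v → length v ℕ.< j → Δ (𝕋 d) (ψ j) v ℚ.≤ κ * ψ j v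
  Δ-ψ {j} v |v|<j = begin
    Δ (𝕋 d) (ψ j) v                                             ≡⟨ Δ-Lap (𝕋 d) (ψ j) (1≤deg v) ⟩
    1/deg v * Lap (𝕋 d) (ψ j) v                                 ≤⟨ *-monoˡ-≤ (1/deg-nonneg (𝕋 d) v) (Lap-ψ v |v|<j) ⟩
    1/deg v * (fromℕ (length (nbrs v)) * (κ * ψ j v))           ≡⟨ ℚ.*-assoc (1/deg v) _ (κ * ψ j v) ⟨
    1/deg v * fromℕ (length (nbrs v)) * (κ * ψ j v)             ≡⟨ cong (_* (κ * ψ j v)) (1/deg-inverse (𝕋 d) v (1≤deg v)) ⟩
    1ℚ * (κ * ψ j v)                                            ≡⟨ ℚ.*-identityˡ (κ * ψ j v) ⟩
    κ * ψ j v                                                   ∎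
    where open ℚ.≤-Reasoning

  Δ-1 : ∀ v → Δ (𝕋 d) (λ _ → 1ℚ) v ≡ 0ℚ
  Δ-1 v = trans (Δ-Lap (𝕋 d) (λ _ → 1ℚ) (1≤deg v))
    (trans (cong (λ s → 1/deg v * (s - fromℕ (length (nbrs v)) * 1ℚ)) (∑-const (nbrs v) 1ℚ))
      (trans (cong (1/deg v *_) (ℚ.+-inverseʳ (fromℕ (length (nbrs v)) * 1ℚ))) (ℚ.*-zeroʳ (1/deg v))))

  -- Sweeping the balls.

  Ψ : ℕ → (V → ℚ) → ℚ
  Ψ j f = Φ (𝕋 d) (ball j) (ψ j) f

  mass-in : List V → (V → ℚ) → ℚ
  mass-in S f = Φ (𝕋 d) S (λ _ → 1ℚ) f

  -- The constant 1 is harmonic, and no neighbour of `v` lies beyond level `n`, so `Φ-gain-≤` and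
  -- `Φ-gain-≥` both apply.
  mass-in-gain : ∀ {n v} → length v ℕ.< n → mass-in (ball (suc n)) (gain (𝕋 d) v) ≡ 0ℚ
  mass-in-gain {n} {v} |v|<n = ℚ.≤-antisym
    (subst (mass-in (ball (suc n)) (gain (𝕋 d) v) ℚ.≤_) (Δ-1 v)
      (Φ-gain-≤ (𝕋 d) (ball-unique (suc n)) v∈ (λ _ → 0≤1)))
    (subst (ℚ._≤ mass-in (ball (suc n)) (gain (𝕋 d) v)) (Δ-1 v)
      (Φ-gain-≥ (𝕋 d) (ball-unique (suc n)) v∈ (All.tabulate (λ {y} y∈ → ∈-ball⁺ y
        (s≤s (ℕ.≤-trans (~⇒length≤ {v} {y} (Equivalence.to (Graph.∈-nbrs (𝕋 d)) y∈)) |v|<n))))))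
    where
    v∈ : v ∈ ball (suc n)
    v∈ = ∈-ball⁺ v (ℕ.m<n⇒m<1+n |v|<n)

  -- No stage up to `n` topples outside `ball n`, so a single conservation law, for the levels up to
  -- `n`, serves all of them.
  State : ℕ → ℕ → (V → ℚ) → Set
  State n K f = Reachable (𝕋 d) root K f × mass-in (ball (suc n)) f ≡ 1ℚ

  sweep-ball : ∀ {n K f} j → j ≤ n → State n K f →
    ∃[ f′ ] State n (length (ball j) ℕ.+ K) f′ × Ψ j f′ ℚ.≤ θ * Ψ j f
  sweep-ball {n} {K} {f} j j≤n (r , unit) =
    let f′ , r′ , eq = sweep (𝕋 d) root {K} {f} f (ball j) (ball-unique j) 0≤f (λ _ → ℚ.≤-refl) r
    in f′ ,
      (r′ , trans (eq (ball (suc n)) (λ _ → 1ℚ)) (trans (cong (mass-in (ball (suc n)) f +_) conserved)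
        (trans (ℚ.+-identityʳ _) unit))) ,
      (begin
        Ψ j f′
          ≡⟨ eq (ball j) (ψ j) ⟩
        Ψ j f + ∑ (ball j) (λ x → f x * Φ (𝕋 d) (ball j) (ψ j) (gain (𝕋 d) x))
          ≤⟨ ℚ.+-monoʳ-≤ (Ψ j f) (Φ-decreases (𝕋 d) {ball j} {ball j} {f} {ψ j} {κ} (ball-unique j) (λ x∈ → x∈) 0≤f
               (ψ-nonneg j) (λ {x} x∈ → Δ-ψ x (∈-ball⁻ x∈))) ⟩
        Ψ j f + κ * Ψ j f
          ≡⟨ solve 1 (λ a → a :+ con κ :* a := con θ :* a) refl (Ψ j f) ⟩
        θ * Ψ j f ∎)
    where
    open ℚ.≤-Reasoning
    0≤f : ∀ x → 0ℚ ℚ.≤ f x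
    0≤f = reachable-nonneg (𝕋 d) root {K} {f} r
    conserved : ∑ (ball j) (λ x → f x * mass-in (ball (suc n)) (gain (𝕋 d) x)) ≡ 0ℚ
    conserved = ℚ.≤-antisym
      (subst (∑ (ball j) (λ x → f x * mass-in (ball (suc n)) (gain (𝕋 d) x)) ℚ.≤_) (∑-zero (ball j))
        (∑-mono (ball j) (λ x∈ → ℚ.≤-reflexive (vanish x∈))))
      (subst (ℚ._≤ ∑ (ball j) (λ x → f x * mass-in (ball (suc n)) (gain (𝕋 d) x))) (∑-zero (ball j))
        (∑-mono (ball j) (λ x∈ → ℚ.≤-reflexive (sym (vanish x∈)))))
      where
      vanish : ∀ {x} → x ∈ ball j → f x * mass-in (ball (suc n)) (gain (𝕋 d) x) ≡ 0ℚ
      vanish {x} x∈ = trans (cong (f x *_) (mass-in-gain (ℕ.<-≤-trans (∈-ball⁻ x∈) j≤n))) (ℚ.*-zeroʳ (f x))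

  sweeps : ∀ {n K f} j r → j ≤ n → State n K f →
    ∃[ f′ ] State n (r ℕ.* length (ball j) ℕ.+ K) f′ × Ψ j f′ ℚ.≤ θ ^ℚ r * Ψ j f
  sweeps {f = f} j zero    j≤n s = f , s , ℚ.≤-reflexive (sym (ℚ.*-identityˡ (Ψ j f)))
  sweeps {n} {K} {f} j (suc r) j≤n s =
    let f₁ , s₁ , h₁ = sweeps j r j≤n s
        f₂ , s₂ , h₂ = sweep-ball j j≤n s₁
    in f₂ , subst (λ k → State n k f₂) (sym (ℕ.+-assoc (length (ball j)) (r ℕ.* length (ball j)) K)) s₂ ,
       ℚ.≤-trans h₂ (ℚ.≤-trans (*-monoˡ-≤ (ℚ.nonNegative⁻¹ θ) h₁)
         (ℚ.≤-reflexive (sym (ℚ.*-assoc θ (θ ^ℚ r) (Ψ j f)))))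

  level-mass≤ : ∀ {f n} j → (∀ x → 0ℚ ℚ.≤ f x) → j ≤ n → mass-in (level j) f ℚ.≤ mass-in (ball (suc n)) f
  level-mass≤ {f} {n} j 0≤f j≤n with ℕ.m≤n⇒m<n∨m≡n j≤n
  ... | inj₂ refl = subst (mass-in (level n) f ℚ.≤_) (sym (∑-++ (level n) (ball n) (λ x → 1ℚ * f x)))
    (p≤p+q (∑-nonneg (ball n) (λ x → *-nonneg 0≤1 (0≤f x))))
  level-mass≤ {f} {suc n} j 0≤f _ | inj₁ (s≤s j≤n) = ℚ.≤-trans (level-mass≤ j 0≤f j≤n)
    (subst (mass-in (ball (suc n)) f ℚ.≤_)
      (trans (ℚ.+-comm (mass-in (ball (suc n)) f) (mass-in (level (suc n)) f))
        (sym (∑-++ (level (suc n)) (ball (suc n)) (λ x → 1ℚ * f x))))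
      (p≤p+q (∑-nonneg (level (suc n)) (λ x → *-nonneg 0≤1 (0≤f x)))))

  -- Passing to `j + 1` raises every exponent in `ball j` by one and admits level `j` with exponent
  -- 1.
  Ψ-suc : ∀ j f → Ψ (suc j) f ≡ Λ * (mass-in (level j) f + Ψ j f)
  Ψ-suc j f = begin
    Ψ (suc j) f
      ≡⟨ ∑-++ (level j) (ball j) (λ x → ψ (suc j) x * f x) ⟩
    ∑ (level j) (λ x → ψ (suc j) x * f x) + ∑ (ball j) (λ x → ψ (suc j) x * f x)
      ≡⟨ cong₂ _+_
           (∑-cong-∈ (level j) (λ {x} x∈ → cong (λ k → Λ ^ℚ k * f x)
             (trans (cong (suc j ∸_) (∈-level⁻ {j} {x} x∈)) (ℕ.m+n∸n≡m 1 j))))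
           (∑-cong-∈ (ball j) (λ {x} x∈ → cong (λ k → Λ ^ℚ k * f x) (∸-suc (ℕ.m<n⇒m<1+n (∈-ball⁻ x∈))))) ⟩
    ∑ (level j) (λ x → Λ * 1ℚ * f x) + ∑ (ball j) (λ x → Λ * ψ j x * f x)
      ≡⟨ cong₂ _+_
           (∑-cong (level j) (λ x → ℚ.*-assoc Λ 1ℚ (f x)))
           (∑-cong (ball j) (λ x → ℚ.*-assoc Λ (ψ j x) (f x))) ⟩
    ∑ (level j) (λ x → Λ * (1ℚ * f x)) + ∑ (ball j) (λ x → Λ * (ψ j x * f x))
      ≡⟨ cong₂ _+_ (∑-*ˡ (level j) Λ (λ x → 1ℚ * f x)) (∑-*ˡ (ball j) Λ (λ x → ψ j x * f x)) ⟩
    Λ * mass-in (level j) f + Λ * Ψ j f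
      ≡⟨ ℚ.*-distribˡ-+ Λ (mass-in (level j) f) (Ψ j f) ⟨
    Λ * (mass-in (level j) f + Ψ j f) ∎
    where open ≡-Reasoning

  mass-in-δ : ∀ n → mass-in (ball (suc n)) (δℚ root) ≡ 1ℚ
  mass-in-δ n = Φ-δ-∈ (𝕋 d) (λ _ → 1ℚ) (ball-unique (suc n)) (∈-ball⁺ {suc n} [] (s≤s z≤n))

  module _ {ε : ℚ} {r : ℕ} (0≤ε : 0ℚ ℚ.≤ ε) (ε≤1 : ε ℚ.≤ 1ℚ) (contract : θ ^ℚ r * fromℕ 3 ℚ.≤ ε) where

    stages : ∀ {n} j → j ≤ n → ∃[ f ] State n (r ℕ.* total j) f × Ψ j f ℚ.≤ ε
    stages {n} zero _ = δℚ root ,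
      subst (λ k → State n k (δℚ root)) (sym (ℕ.*-zeroʳ r)) (reachable-δ (𝕋 d) root , mass-in-δ n) , 0≤ε
    stages {n} (suc j) 1+j≤n =
      let f , s@(reach , unit) , Ψ≤ε = stages {n} j (ℕ.<⇒≤ 1+j≤n)
          f′ , s′ , Ψ≤ = sweeps (suc j) r 1+j≤n s
      in f′ , subst (λ k → State n k f′) (sym (ℕ.*-distribˡ-+ r (length (ball (suc j))) (total j))) s′ , (begin
        Ψ (suc j) f′
          ≤⟨ Ψ≤ ⟩
        θ ^ℚ r * Ψ (suc j) f
          ≡⟨ cong (θ ^ℚ r *_) (Ψ-suc j f) ⟩
        θ ^ℚ r * (Λ * (mass-in (level j) f + Ψ j f))
          ≤⟨ *-monoˡ-≤ 0≤θ^r (*-monoˡ-≤ (ℚ.nonNegative⁻¹ Λ) (ℚ.+-mono-≤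
               (ℚ.≤-trans (level-mass≤ j (reachable-nonneg (𝕋 d) root {_} {f} reach) (ℕ.<⇒≤ 1+j≤n)) (ℚ.≤-reflexive unit))
               (ℚ.≤-trans Ψ≤ε ε≤1))) ⟩
        -- `Λ * (1 + 1) = 3`: one unit bounds the mass at level `j`, the other the `ε ≤ 1` left by
        -- the previous stage.
        θ ^ℚ r * fromℕ 3
          ≤⟨ contract ⟩
        ε ∎)
      where
      open ℚ.≤-Reasoning
      0≤θ^r : 0ℚ ℚ.≤ θ ^ℚ r
      0≤θ^r = ^ℚ-nonneg (ℚ.nonNegative⁻¹ θ) r

    upper-bound : ∀ (em : ExcludedMiddle 0ℓ) {p} n → p ≤ᴿ fromℚ (1ℚ - ε) →
      ∃[ k ] k ≤ r ℕ.* (2 ℕ.* d ^ n) × Transportable p (Ball em (𝕋 d) root n) (δ root) k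
    upper-bound em {p} n p≤ =
      let f , (reach , unit) , Ψ≤ε = stages {n} n ℕ.≤-refl
          k , k≤ , t = reachable-mass (𝕋 d) root {Ball em (𝕋 d) root n} {p} {1ℚ - ε} {r ℕ.* total n} {f}
            (level n) (level-unique n)
            (All.tabulate (λ {x} x∈ → ∉-Ball⁺ em x (ℕ.≤-reflexive (sym (∈-level⁻ x∈)))))
            p≤ (mass-at-level f (reachable-nonneg (𝕋 d) root {_} {f} reach) unit Ψ≤ε) reach
      in k , ℕ.≤-trans k≤ (ℕ.*-monoʳ-≤ r (total-≤ n)) , t
      where
      open ℚ.≤-Reasoning
      -- All weights are at least 1, so `Ψ n f ≤ ε` leaves at most `ε` of the unit mass in `ball n`.
      mass-at-level : ∀ f → (∀ x → 0ℚ ℚ.≤ f x) → mass-in (ball (suc n)) f ≡ 1ℚ → Ψ n f ℚ.≤ ε →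
        1ℚ - ε ℚ.≤ ∑ (level n) f
      mass-at-level f 0≤f unit Ψ≤ε = begin
        1ℚ - ε
          ≤⟨ ℚ.+-monoʳ-≤ 1ℚ (ℚ.neg-antimono-≤ Ψ≤ε) ⟩
        1ℚ - Ψ n f
          ≤⟨ ℚ.+-monoʳ-≤ 1ℚ (ℚ.neg-antimono-≤ (∑-mono (ball n) (λ {x} _ → *-monoʳ-≤ (0≤f x) (1≤ψ n x)))) ⟩
        1ℚ - mass-in (ball n) f
          ≡⟨ cong (_- mass-in (ball n) f) (trans (sym unit) (∑-++ (level n) (ball n) (λ x → 1ℚ * f x))) ⟩
        mass-in (level n) f + mass-in (ball n) f - mass-in (ball n) f
          ≡⟨ solve 2 (λ a b → a :+ b :- b := a) refl (mass-in (level n) f) (mass-in (ball n) f) ⟩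
        mass-in (level n) f
          ≡⟨ ∑-cong (level n) (λ x → ℚ.*-identityˡ (f x)) ⟩
        ∑ (level n) f ∎

  -- The number of sweeps per stage.

  -- Bernoulli's inequality for `1/θ = 1 + 1/17`; the induction step rests on `θ * (1 + s) = 1`.
  bernoulli : ∀ r → θ ^ℚ r * (1ℚ + fromℕ r * (pos 1 ℚ./ 17)) ℚ.≤ 1ℚ
  bernoulli zero    = ℚ.≤-refl
  bernoulli (suc r) = begin
    θ * θ ^ℚ r * (1ℚ + fromℕ (suc r) * s)
      ≡⟨ cong (λ a → θ * θ ^ℚ r * (1ℚ + a * s)) (fromℕ-suc r) ⟩
    θ * θ ^ℚ r * (1ℚ + (1ℚ + fromℕ r) * s)
      ≡⟨ solve 2 (λ x k → con θ :* x :* (con 1ℚ :+ (con 1ℚ :+ k) :* con s) := x :* (con 1ℚ :+ k :* con (θ * s)))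
           refl (θ ^ℚ r) (fromℕ r) ⟩
    θ ^ℚ r * (1ℚ + fromℕ r * (θ * s))
      ≤⟨ *-monoˡ-≤ (^ℚ-nonneg (ℚ.nonNegative⁻¹ θ) r) (ℚ.+-monoʳ-≤ 1ℚ (*-monoˡ-≤ (fromℕ-nonneg r)
           (p≤p+q {θ * s} {s - θ * s} (ℚ.nonNegative⁻¹ (s - θ * s))))) ⟩
    θ ^ℚ r * (1ℚ + fromℕ r * s)
      ≤⟨ bernoulli r ⟩
    1ℚ ∎
    where
    open ℚ.≤-Reasoning
    s = pos 1 ℚ./ 17

  contraction : ∀ {ε} → 0ℚ ℚ.< ε → ∃[ r ] θ ^ℚ r * fromℕ 3 ℚ.≤ ε
  -- With `51 = 3 * 17` the Bernoulli factor is at least `3 b`, and `b * ε ≥ 1` absorbs the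
  -- remaining factor.
  contraction {ε} 0<ε with b , 1≤bε ← archimedean 0<ε = 51 ℕ.* b , (begin
    x * fromℕ 3
      ≡⟨ solve 1 (λ x → x :* con (fromℕ 3) := x :* con (fromℕ 3) :* con 1ℚ) refl x ⟩
    x * fromℕ 3 * 1ℚ
      ≤⟨ *-monoˡ-≤ (*-nonneg 0≤x (fromℕ-nonneg 3)) 1≤bε ⟩
    x * fromℕ 3 * (fromℕ b * ε)
      ≡⟨ solve 3 (λ x b e → x :* con (fromℕ 3) :* (b :* e) := x :* (con (fromℕ 51) :* b :* con s) :* e) refl x (fromℕ b) ε ⟩
    x * (fromℕ 51 * fromℕ b * s) * ε
      ≡⟨ cong (λ a → x * (a * s) * ε) (fromℕ-* 51 b) ⟨
    x * (fromℕ (51 ℕ.* b) * s) * ε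
      ≤⟨ *-monoʳ-≤ (ℚ.<⇒≤ 0<ε) (*-monoˡ-≤ 0≤x (subst (fromℕ (51 ℕ.* b) * s ℚ.≤_)
           (ℚ.+-comm (fromℕ (51 ℕ.* b) * s) 1ℚ) (p≤p+q 0≤1))) ⟩
    x * (1ℚ + fromℕ (51 ℕ.* b) * s) * ε
      ≤⟨ *-monoʳ-≤ (ℚ.<⇒≤ 0<ε) (bernoulli (51 ℕ.* b)) ⟩
    1ℚ * ε
      ≡⟨ ℚ.*-identityˡ ε ⟩
    ε ∎)
    where
    open ℚ.≤-Reasoning
    s = pos 1 ℚ./ 17
    x = θ ^ℚ (51 ℕ.* b)
    0≤x : 0ℚ ℚ.≤ x
    0≤x = ^ℚ-nonneg (ℚ.nonNegative⁻¹ θ) (51 ℕ.* b)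

-- Rational constants from `p`, and the two bounds combined.

rational-below : ∀ {x} → 0ᴿ <ᴿ x → ∃[ q ] 0ℚ ℚ.< q × fromℚ q <ᴿ x
rational-below {x} (ε , 0<ε , N , h) = ½ * ε , half-pos 0<ε , ½ * ε , half-pos 0<ε , N , λ n N≤n →
  subst (ℚ._≤ seq x n) (trans (sym (half-sum 0ℚ ε)) (cong (_+ ½ * ε) (ℚ.+-identityˡ (½ * ε)))) (h n N≤n)

gap-below-1 : ∀ {x} → 0ᴿ <ᴿ x → x <ᴿ 1ᴿ → ∃[ ε ] 0ℚ ℚ.< ε × ε ℚ.≤ 1ℚ × x ≤ᴿ fromℚ (1ℚ - ε)
gap-below-1 {x} (η , 0<η , M , g) (ε , 0<ε , N , h) = ε , 0<ε , ε≤1 , x≤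
  where
  n = M ℕ.⊔ N
  -- At an index where `x` is already positive, `x + ε ≤ 1` forces this.
  ε≤1 : ε ℚ.≤ 1ℚ
  ε≤1 = ℚ.≤-trans
    (subst (ℚ._≤ seq x n + ε) (ℚ.+-identityˡ ε) (ℚ.+-monoˡ-≤ ε
      (ℚ.≤-trans (subst (0ℚ ℚ.≤_) (sym (ℚ.+-identityˡ η)) (ℚ.<⇒≤ 0<η)) (g n (ℕ.m≤m⊔n M N)))))
    (h n (ℕ.m≤n⊔m M N))
  x≤ : x ≤ᴿ fromℚ (1ℚ - ε)
  x≤ ζ 0<ζ = N , λ k N≤k → ℚ.≤-trans
    (subst (ℚ._≤ 1ℚ - ε) (solve 2 (λ a e → a :+ e :- e := a) refl (seq x k) ε) (ℚ.+-monoˡ-≤ (- ε) (h k N≤k)))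
    (p≤p+q (ℚ.<⇒≤ 0<ζ))

theorem1p5 :
  (em : ExcludedMiddle 0ℓ) (d : ℕ) → 2 ≤ d →
  (p : ℝ) → 0ᴿ <ᴿ p → p <ᴿ 1ᴿ →
  ∃[ c ] ∃[ C ] ∃[ n₀ ] 0ᴿ <ᴿ c × c ≤ᴿ C ×
    (∀ (n : ℕ) → n ≥ n₀ →
      let open Toppling (𝕋 d)
          Nₙ = Nₚ em p (𝕋 d) (Ball em (𝕋 d) root n) (δ root)
      in [ fromℕ (d ^ n) · c ] ≤∞ fromℕ∞ Nₙ × fromℕ∞ Nₙ ≤∞ [ fromℕ (d ^ n) · C ])
theorem1p5 em d 2≤d p 0<p p<1 =
  fromℚ c , fromℚ C , 1 , (c , 0<c , 0 , λ _ _ → ℚ.≤-reflexive (ℚ.+-identityˡ c)) ,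
  ≤ᴿ-pointwise {fromℚ c} {fromℚ C} (λ _ → p≤p+q (fromℕ-nonneg (r ℕ.* 2))) , bounds
  where
  open Tree d 2≤d
  open Toppling (𝕋 d) using (δ; Transportable)
  q = proj₁ (rational-below {p} 0<p)
  0<q = proj₁ (proj₂ (rational-below {p} 0<p))
  q<p = proj₂ (proj₂ (rational-below {p} 0<p))
  gap = gap-below-1 {p} 0<p p<1
  ε = proj₁ gap
  0<ε = proj₁ (proj₂ gap)
  ε≤1 = proj₁ (proj₂ (proj₂ gap))
  p≤1-ε = proj₂ (proj₂ (proj₂ gap))
  r = proj₁ (contraction 0<ε)
  c = q * (½ * ι)
  -- The upper bound produces `2 r`; adding `c` makes `c ≤ C` immediate.
  C = c + fromℕ (r ℕ.* 2)
  0<c : 0ℚ ℚ.< c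
  0<c = ℚ.positive⁻¹ c {{ℚ.pos*pos⇒pos q {{ℚ.positive 0<q}} (½ * ι) {{ℚ.positive (half-pos 0<ι)}}}}
  P : ℕ → Pred ℕ 0ℓ
  P n = Transportable p (Ball em (𝕋 d) root n) (δ root)
  at-least : ∀ n {k} → P (suc n) k → fromℕ (d ^ suc n) * c ℚ.≤ fromℕ k
  at-least n {k} t = subst (λ a → a * c ℚ.≤ fromℕ k) (sym (fromℕ-^ d (suc n)))
    (lower-bound em {p} {q} {k} n q<p t)
  at-most : ∀ n {k} → k ≤ r ℕ.* (2 ℕ.* d ^ n) → fromℕ k ℚ.≤ fromℕ (d ^ n) * C
  at-most n {k} k≤ = begin
    fromℕ k                                                ≤⟨ fromℕ-mono k≤ ⟩
    fromℕ (r ℕ.* (2 ℕ.* d ^ n))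
      ≡⟨ cong fromℕ (trans (sym (ℕ.*-assoc r 2 (d ^ n))) (ℕ.*-comm (r ℕ.* 2) (d ^ n))) ⟩
    fromℕ (d ^ n ℕ.* (r ℕ.* 2))                            ≡⟨ fromℕ-* (d ^ n) (r ℕ.* 2) ⟩
    fromℕ (d ^ n) * fromℕ (r ℕ.* 2)
      ≤⟨ *-monoˡ-≤ (fromℕ-nonneg (d ^ n)) (subst (fromℕ (r ℕ.* 2) ℚ.≤_)
           (ℚ.+-comm (fromℕ (r ℕ.* 2)) c) (p≤p+q (ℚ.<⇒≤ 0<c))) ⟩
    fromℕ (d ^ n) * C                                      ∎
    where open ℚ.≤-Reasoning
  bounds : ∀ n → n ≥ 1 →
    [ fromℕ (d ^ n) · fromℚ c ] ≤∞ fromℕ∞ (minimum em (P n)) ×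
    fromℕ∞ (minimum em (P n)) ≤∞ [ fromℕ (d ^ n) · fromℚ C ]
  bounds (suc n) _ =
    let k , k≤ , t = upper-bound {ε} {r} (ℚ.<⇒≤ 0<ε) ε≤1 (proj₂ (contraction 0<ε)) em {p} (suc n) p≤1-ε
        j , eq , tⱼ , j≤k = minimum-≤ em (P (suc n)) k t
    in subst (λ N → [ fromℕ (d ^ suc n) · fromℚ c ] ≤∞ fromℕ∞ N ×
                  fromℕ∞ N ≤∞ [ fromℕ (d ^ suc n) · fromℚ C ]) (sym eq)
         ( NonStrict.[ ≤ᴿ-pointwise {fromℕ (d ^ suc n) · fromℚ c} {fromℚ (fromℕ j)} (λ _ → at-least n tⱼ) ]
         , NonStrict.[ ≤ᴿ-pointwise {fromℚ (fromℕ j)} {fromℕ (d ^ suc n) · fromℚ C}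
             (λ _ → at-most (suc n) (ℕ.≤-trans j≤k k≤)) ] )
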